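{- Let $\mathbf T$ be a countable homogeneous tournament with its fixed expansion $\mathbf T^*$ (described in the context). Then the class $\mathrm{Age}(I_\omega[\mathbf T]^*)$ has the Ramsey property.
   Context: The countable homogeneous tournaments are $I_1$, the 3-cycle $C_3$ on $\{0,1,2\}$, $\mathbb Q$ (with $E(x,y)$ iff $x<y$), the dense local order $\mathbf S(2)$ (a countable dense subset $D$ of the unit circle with no antipodal points and not containing the points at angles $\pi/2,3\pi/2$, with $E(x,y)$ iff the counterclockwise angle from $x$ to $y$ is in $(0,\pi)$), and the generic tournament $T^\omega$. Fixed expansions $\mathbf T^*$, containing $E$ and a binary $<$ interpreted as a linear order $<^*$: $I_1^*$ adds one unary predicate true at its vertex; $C_3^*$ adds three unary predicates, the $i$-th true exactly at $i$, and a fixed linear order; $\mathbb Q^*$ adds the usual order; $\mathbf S(2)^*$ adds two unary predicates for the two halves of $D$ cut by the line through angles $\pi/2,3\pi/2$ and the order $x<y$ iff ($x,y$ in the same half and $E(x,y)$) or (different halves and $E(y,x)$); $T^{\omega*}$ is the Fraïssé limit of all finite linearly ordered tournaments. $I_\omega[\mathbf T]^*$ has universe $\mathbb N\times T$; for each relation $R$ of $\mathbf T^*$ other than $<$ (including $E$), $R((k_1,x_1),\dots,(k_m,x_m))$ iff $k_1=\dots=k_m$ and $R^{\mathbf T^*}(x_1,\dots,x_m)$; and $(i,x)<(j,y)$ iff $i\prec j$ or ($i=j$ and $x<^*y$), where $\prec$ is a dense linear order on $\mathbb N$ (isomorphic to $\mathbb Q$). No unary predicates distinguishing the copies are added. The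 age of a structure is the class of finite structures embeddable in it. A class $\mathcal K$ of finite structures has the Ramsey property if for all $k\in\mathbb N$ and $\mathbf A,\mathbf B\in\mathcal K$ there is $\mathbf C\in\mathcal K$ such that for every colouring of the substructures of $\mathbf C$ isomorphic to $\mathbf A$ with $k$ colours there is a substructure $\mathbf B'\cong\mathbf B$ of $\mathbf C$ on whose substructures isomorphic to $\mathbf A$ the colouring is constant. -}

module Defs where

open import Data.Nat as ℕ using (ℕ; zero; suc)
open import Data.Nat.DivMod using (_%_)
open import Data.Integer using (+_)
open import Data.Rational as ℚ using (ℚ; 0ℚ; 1ℚ; ½; _-_)
open import Data.Fin as Fin using (Fin)
open import Data.Fin.Subset using (Subset; _∈_; _⊆_)
open import Data.Unit using (⊤)
open import Data.Empty using (⊥)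
open import Data.Product using (Σ; _×_; _,_; proj₁; ∃)
open import Data.Sum using (_⊎_)
open import Relation.Binary.PropositionalEquality using (_≡_)
open import Relation.Nullary using (¬_)

record Str (k : ℕ) : Set₁ where
  field
    Carrier : Set
    E       : Carrier → Carrier → Set
    Lt      : Carrier → Carrier → Set
    P       : Fin k → Carrier → Set

open Str public

record FinStr (k : ℕ) : Set₁ where
  field
    size : ℕ
    FE   : Fin size → Fin size → Set
    FLt  : Fin size → Fin size → Set
    FP   : Fin k → Fin size → Set

open FinStr public

fin : ∀ {k} → FinStr k → Str k
fin A = record { Carrier = Fin (size A) ; E = FE A ; Lt = FLt A ; P = FP A }

_⇔_ : Set → Set → Set
X ⇔ Y = (X → Y) × (Y → X)

record Emb {k : ℕ} (A B : Str k) : Set where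
  field
    map  : Carrier A → Carrier B
    inj  : ∀ x y → map x ≡ map y → x ≡ y
    presE  : ∀ x y → E A x y ⇔ E B (map x) (map y)
    presLt : ∀ x y → Lt A x y ⇔ Lt B (map x) (map y)
    presP  : ∀ i x → P A i x ⇔ P B i (map x)

open Emb public

Age : ∀ {k} → Str k → FinStr k → Set
Age M A = Emb (fin A) M

IsCopy : ∀ {k} (A C : FinStr k) → Subset (size C) → Set
IsCopy A C S = Σ (Emb (fin A) (fin C)) λ f →
  ∀ i → (i ∈ S) ⇔ (∃ λ j → map f j ≡ i)

-- Ramsey property of a class of finite structures.
-- A colouring of the copies of A in C with r colours is given as a map
-- on all subsets of C (only its values on copies of A matter).
RamseyProperty : ∀ {k} → (FinStr k → Set) → Set₁
RamseyProperty {k} K =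
  ∀ (r : ℕ) (A B : FinStr k) → K A → K B →
  Σ (FinStr k) λ C → K C ×
    (∀ (χ : Subset (size C) → Fin r) →
       Σ (Subset (size C)) λ B' → IsCopy B C B' ×
         Σ (Fin r) λ c → ∀ S → S ⊆ B' → IsCopy A C S → χ S ≡ c)

I1* : Str 1
I1* = record { Carrier = ⊤ ; E = λ _ _ → ⊥ ; Lt = λ _ _ → ⊥ ; P = λ _ _ → ⊤ }

data C3E : Fin 3 → Fin 3 → Set where
  e01 : C3E Fin.zero (Fin.suc Fin.zero)
  e12 : C3E (Fin.suc Fin.zero) (Fin.suc (Fin.suc Fin.zero))
  e20 : C3E (Fin.suc (Fin.suc Fin.zero)) Fin.zero

C3* : Str 3
C3* = record { Carrier = Fin 3 ; E = C3E ; Lt = Fin._<_ ; P = λ i x → i ≡ x }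

Q* : Str 0
Q* = record { Carrier = ℚ ; E = ℚ._<_ ; Lt = ℚ._<_ ; P = λ () }

-- S(2)^* : a point of the circle at angle 2πq is represented by q ∈ [0,1).
-- D = rationals in [0,1) with odd denominator: countable, dense, no
-- antipodal pairs (q + 1/2 has even denominator), avoids q = 1/4, 3/4.
D : Set
D = Σ ℚ λ q → (0ℚ ℚ.≤ q) × (q ℚ.< 1ℚ) × (ℚ.denominatorℕ q % 2 ≡ 1)

¼ ¾ : ℚ
¼ = + 1 ℚ./ 4
¾ = + 3 ℚ./ 4

-- counterclockwise angle from x to y lies in (0, π)
S2E : D → D → Set
S2E (x , _) (y , _) = ((x ℚ.< y) × (y - x ℚ.< ½)) ⊎ ((y ℚ.< x) × (½ ℚ.< x - y))

-- the two halves cut by the line through angles π/2 and 3π/2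
Half₀ Half₁ : D → Set
Half₀ (x , _) = (x ℚ.< ¼) ⊎ (¾ ℚ.< x)
Half₁ (x , _) = (¼ ℚ.< x) × (x ℚ.< ¾)

HalfP : Fin 2 → D → Set
HalfP Fin.zero = Half₀
HalfP (Fin.suc _) = Half₁

SameHalf : D → D → Set
SameHalf x y = (Half₀ x × Half₀ y) ⊎ (Half₁ x × Half₁ y)

S2Lt : D → D → Set
S2Lt x y = (SameHalf x y × S2E x y) ⊎ (¬ SameHalf x y × S2E y x)

S2* : Str 2
S2* = record { Carrier = D ; E = S2E ; Lt = S2Lt ; P = HalfP }

-- T^{ω*} : characterised (up to isomorphism) as a countable structure
-- (universe ℕ) which is a linearly ordered tournament and has the
-- extension property for the class of finite linearly ordered tournaments.
IsLOTournament : Str 0 → Set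
IsLOTournament M =
  (∀ x → ¬ E M x x) ×
  (∀ x y → ¬ x ≡ y → E M x y ⊎ E M y x) ×
  (∀ x y → E M x y → ¬ E M y x) ×
  (∀ x → ¬ Lt M x x) ×
  (∀ x y z → Lt M x y → Lt M y z → Lt M x z) ×
  (∀ x y → ¬ x ≡ y → Lt M x y ⊎ Lt M y x)

IsGenericLOTournament : Str 0 → Set₁
IsGenericLOTournament M =
  (Carrier M ≡ ℕ) × IsLOTournament M ×
  (∀ (A B : FinStr 0) → IsLOTournament (fin A) → IsLOTournament (fin B) →
    (e : Emb (fin A) (fin B)) (f : Emb (fin A) M) →
    Σ (Emb (fin B) M) λ g → ∀ a → map g (map e a) ≡ map f a)

-- I_ω[T]^* with the dense index order taken to be ℚ itself.

Iω* : ∀ {k} → Str k → Str k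
Iω* T = record
  { Carrier = ℚ × Carrier T
  ; E  = λ { (i , x) (j , y) → (i ≡ j) × E T x y }
  ; Lt = λ { (i , x) (j , y) → (i ℚ.< j) ⊎ ((i ≡ j) × Lt T x y) }
  ; P  = λ { m (i , x) → P T m x }
  }

data HomTournament : Set₁ where
  I₁ C₃ ℚ-tour S₂ : HomTournament
  Tω : (M : Str 0) → IsGenericLOTournament M → HomTournament

arity : HomTournament → ℕ
arity I₁ = 1
arity C₃ = 3
arity ℚ-tour = 0
arity S₂ = 2
arity (Tω _ _) = 0

expansion : (T : HomTournament) → Str (arity T)
expansion I₁ = I1*
expansion C₃ = C3*
expansion ℚ-tour = Q*
expansion S₂ = S2*
expansion (Tω M _) = M

{-# OPTIONS --safe #-}
module Submission where

open import Defs

open import Data.Bool.Base using (Bool; true; false; not; if_then_else_)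
import Data.Bool.Properties as Boolₚ
open import Data.Empty using (⊥; ⊥-elim)
open import Data.Fin.Base as Fin using (Fin; zero; suc; finToFun; funToFin; combine; remQuot)
open import Data.Fin.Properties as Finₚ using (any?; all?; pigeonhole; finToFun-funToFin; combine-remQuot; remQuot-combine)
open import Data.Fin.Subset as Subset using (Subset)
import Data.Fin.Subset.Properties as Subsetₚ
open import Data.Integer.Base as ℤ using (ℤ; +_; +<+)
import Data.Integer.Properties as ℤₚ
open import Data.List.Base as List using (List; []; _∷_)
open import Data.List.Membership.Propositional using (_∈_)
open import Data.List.Membership.Propositional.Properties using (∈-++⁺ˡ; ∈-++⁺ʳ; ∈-++⁻; ∈-map⁺; ∈-tabulate⁺; ∈-tabulate⁻; ∈-lookup)
open import Data.List.Relation.Unary.All as All using ([]; _∷_)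
open import Data.List.Relation.Unary.AllPairs using (AllPairs; []; _∷_)
open import Data.List.Relation.Unary.Any as Any using (here; there)
open import Data.List.Relation.Unary.Any.Properties using (lookup-index)
open import Data.Maybe.Base as Maybe using (Maybe; just; nothing; fromMaybe)
open import Data.Nat.Base as ℕ using (ℕ; zero; suc; _+_; _*_; _^_; z≤n; s≤s)
import Data.Nat.Coprimality as Coprimality
open import Data.Nat.Divisibility using (_∣_; divides; ∣m⇒∣m*n; m%n≡0⇒n∣m; n∣m⇒m%n≡0)
open import Data.Nat.DivMod using (_%_; [m+kn]%n≡m%n; m%n<n; %-distribˡ-*)
open import Data.Nat.GCD using (gcd)
import Data.Nat.Properties as ℕₚ
open import Data.Product using (Σ; ∃; _×_; _,_; proj₁; proj₂)
open import Data.Rational.Base as ℚ using (ℚ; mkℚ; *<*; 0ℚ; 1ℚ; ½; toℚᵘ)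
import Data.Rational.Properties as ℚₚ
open import Data.Rational.Unnormalised.Base as ℚᵘ using (mkℚᵘ)
import Data.Rational.Unnormalised.Properties as ℚᵘₚ
open import Data.Sum.Base using (_⊎_; inj₁; inj₂; swap)
open import Data.Unit.Base using (tt)
open import Data.Vec.Base as Vec using (Vec; []; _∷_; _++_; lookup; tabulate)
import Data.Vec.Properties as Vecₚ
open import Function.Base using (_∘_; id)
open import Relation.Binary.Definitions using (tri<; tri≈; tri>; DecidableEquality)
open import Relation.Binary.PropositionalEquality using (_≡_; refl; sym; trans; cong; cong₂; subst; subst₂; module ≡-Reasoning)
open import Relation.Nullary using (¬_; Dec; yes; no; does)
open import Relation.Nullary.Decidable using (_×-dec_; map′; from-yes)

-- A structure in the age is a chain of blocks, each a finite ordered tournament.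
-- Put a marker in front of every block. An embedding A → B then extends to the
-- markers as an embedding of linear orders with one binary relation, for which
-- the Ramsey property is proved by the partite construction (Hales–Jewett for one
-- set of parts at a time, Ramsey's theorem for the choice of parts). A copy h of
-- the marked A gives the copy x ↦ (h (marker of x) , h x) of A in a chain of equal
-- blocks, and the second coordinate only has to be realised inside T*, which for
-- I₁, C₃, ℚ and S(2) uses the order and the unary predicates alone, and for the
-- generic tournament the extension property.
--
-- In the partite construction the amalgamation is replaced by a power: vertices of
-- the next system are partial words, so vertices outside the chosen parts can be
-- left undefined at the fixed coordinates of a line.

-- The Hales–Jewett theorem

-- The age is constrained: two points of one block always carry an edge. A Boolean relation on a
-- linear order is unconstrained, so whatever the partite construction produces is acceptable. The
-- transfer back runs in one direction. A colouring of the copies of `A` in the target is pulled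
-- back to all pairs of a choice of parts and a choice of vertices, and only copies inside the
-- chosen copy of `B` have to be matched; these factor through `B`. What must hold is naturality: an
-- embedding of `A` in `B` moves points of T* to unrelated points with the same unary predicates, so
-- beyond its part and vertex a point may influence its place only through those predicates. Markers
-- answer the same demand. The block coordinate must be one value for all points of a block, but `A`
-- may contain only some points of a block of `B`, so no point of the block, such as the first one,
-- can label it naturally.

Line : ℕ → ℕ → Set
Line k N = Vec (Maybe (Fin k)) N

infixl 8 _at_

_at_ : ∀ {k N} → Line k N → Fin k → Vec (Fin k) N
l at x = Vec.map (fromMaybe x) l

Active : ∀ {k N} → Line k N → Set
Active l = ∃ λ i → lookup l i ≡ nothing

MonoLine : ∀ {k r N} → (Vec (Fin k) N → Fin r) → Set
MonoLine {k} {r} {N} χ =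
  Σ (Line k N) λ l → Active l × (∀ x y → χ (l at x) ≡ χ (l at y))

HalesJewett : ℕ → Set
HalesJewett k = ∀ r → ∃ λ N → ∀ (χ : Vec (Fin k) N → Fin r) → MonoLine χ

constLine : ∀ {k N} → Vec (Fin k) N → Line k N
constLine = Vec.map just

constLine-at : ∀ {k N} (w : Vec (Fin k) N) x → constLine w at x ≡ w
constLine-at w x = trans (sym (Vecₚ.map-∘ (fromMaybe x) just w)) (Vecₚ.map-id w)

++-at : ∀ {k M N} (l : Line k M) (l′ : Line k N) x → (l ++ l′) at x ≡ l at x ++ l′ at x
++-at l l′ x = Vecₚ.map-++ (fromMaybe x) l l′

active-++ˡ : ∀ {k M N} (l : Line k M) (l′ : Line k N) → Active l → Active (l ++ l′)
active-++ˡ l l′ (i , eq) = i Fin.↑ˡ _ , trans (Vecₚ.lookup-++ˡ l l′ i) eq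

active-++ʳ : ∀ {k M N} (l : Line k M) (l′ : Line k N) → Active l′ → Active (l ++ l′)
active-++ʳ {M = M} l l′ (i , eq) = M Fin.↑ʳ i , trans (Vecₚ.lookup-++ʳ l l′ i) eq

liftLine : ∀ {k N} → Line k N → Line (suc k) N
liftLine = Vec.map (Maybe.map suc)

liftLine-at : ∀ {k N} (l : Line k N) x → liftLine l at suc x ≡ Vec.map suc (l at x)
liftLine-at []            x = refl
liftLine-at (just y ∷ l)  x = cong (suc y ∷_) (liftLine-at l x)
liftLine-at (nothing ∷ l) x = cong (suc x ∷_) (liftLine-at l x)

active-lift : ∀ {k N} (l : Line k N) → Active l → Active (liftLine l)
active-lift l (i , eq) = i , trans (Vecₚ.lookup-map i (Maybe.map suc) l) (cong (Maybe.map suc) eq)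

-- Colour focusing with `zero` as the distinguished letter. Since the colours are distinct, at most
-- `r` such lines exist, so asking for `suc r` of them leaves only a monochromatic line.
record Focused {k r N} (χ : Vec (Fin (suc k)) N → Fin r) (s : ℕ) : Set where
  field
    focus     : Vec (Fin (suc k)) N
    line      : Fin s → Line (suc k) N
    active    : ∀ i → Active (line i)
    focusing  : ∀ i → line i at zero ≡ focus
    colour    : Fin s → Fin r
    coloured  : ∀ i x → χ (line i at suc x) ≡ colour i
    distinct  : ∀ i j → colour i ≡ colour j → i ≡ j

module _ {k : ℕ} (hj : HalesJewett (suc k)) where
  open Focused

  -- `M` new coordinates go in front of the `N` old ones. The theorem for one letter fewer, with
  -- whole colourings of the words of length `N` as colours, gives a line in the front block along
  -- which the nonzero letters cannot be told apart.
  focused : ∀ r s → ∃ λ N → ∀ (χ : Vec (Fin (suc (suc k))) N → Fin r) →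
            MonoLine χ ⊎ Focused χ s
  focused r zero = 0 , λ χ → inj₂ (record
    { focus = [] ; line = λ () ; active = λ () ; focusing = λ () ; colour = λ ()
    ; coloured = λ () ; distinct = λ () })
  focused r (suc s) with focused r s
  ... | N , ih with hj (r ^ (suc (suc k) ^ N))
  ... | M , hjM = M + N , extend
    where
    module _ (χ : Vec (Fin (suc (suc k))) (M + N) → Fin r) where

      χ₁ : Vec (Fin (suc k)) M → Fin (r ^ (suc (suc k) ^ N))
      χ₁ u = funToFin λ z → χ (Vec.map suc u ++ tabulate (finToFun z))

      χ₁-sound : ∀ u u′ → χ₁ u ≡ χ₁ u′ → ∀ v → χ (Vec.map suc u ++ v) ≡ χ (Vec.map suc u′ ++ v)
      χ₁-sound u u′ eq v = begin
        χ (Vec.map suc u ++ v)                      ≡⟨ decode u ⟨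
        finToFun (χ₁ u) (funToFin (lookup v))       ≡⟨ cong (λ c → finToFun c (funToFin (lookup v))) eq ⟩
        finToFun (χ₁ u′) (funToFin (lookup v))      ≡⟨ decode u′ ⟩
        χ (Vec.map suc u′ ++ v)                     ∎
        where
        open ≡-Reasoning
        decode : ∀ t → finToFun (χ₁ t) (funToFin (lookup v)) ≡ χ (Vec.map suc t ++ v)
        decode t = trans (finToFun-funToFin _ (funToFin (lookup v)))
          (cong (λ z → χ (Vec.map suc t ++ z))
            (trans (Vecₚ.tabulate-cong (finToFun-funToFin (lookup v))) (Vecₚ.tabulate∘lookup v)))

      extend : MonoLine χ ⊎ Focused χ (suc s)
      extend with hjM χ₁
      ... | l₀ , l₀-active , l₀-mono = result (ih χ₂)
        where
        l : Line (suc (suc k)) M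
        l = liftLine l₀

        l-active : Active l
        l-active = active-lift l₀ l₀-active

        stem : Vec (Fin (suc (suc k))) M
        stem = l at suc zero

        χ₂ : Vec (Fin (suc (suc k))) N → Fin r
        χ₂ v = χ (stem ++ v)

        l-indep : ∀ x v → χ (l at suc x ++ v) ≡ χ₂ v
        l-indep x v = trans (cong (λ u → χ (u ++ v)) (liftLine-at l₀ x))
          (trans (χ₁-sound _ _ (l₀-mono x zero) v)
                 (cong (λ u → χ (u ++ v)) (sym (liftLine-at l₀ zero))))

        prepend : MonoLine χ₂ → MonoLine χ
        prepend (m , m-active , m-mono) =
          constLine stem ++ m , active-++ʳ (constLine stem) m m-active ,
          λ x y → trans (cong χ (at-eq x)) (trans (m-mono x y) (cong χ (sym (at-eq y))))
          where
          at-eq : ∀ x → (constLine stem ++ m) at x ≡ stem ++ m at x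
          at-eq x = trans (++-at (constLine stem) m x) (cong (_++ m at x) (constLine-at stem x))

        result : MonoLine χ₂ ⊎ Focused χ₂ s → MonoLine χ ⊎ Focused χ (suc s)
        result (inj₁ m) = inj₁ (prepend m)
        -- If the focus already has the colour of some line, that line is monochromatic at `zero`
        -- too. Otherwise the focus supplies a new colour: the added line moves only in the front
        -- block, while each old line now moves in both blocks.
        result (inj₂ F) with any? (λ i → colour F i Finₚ.≟ χ₂ (focus F))
        ... | yes (i , eq) = inj₁ (prepend (line F i , active F i , λ x y → trans (const x) (sym (const y))))
          where
          const : ∀ x → χ₂ (line F i at x) ≡ colour F i
          const zero    = trans (cong χ₂ (focusing F i)) (sym eq)
          const (suc x) = coloured F i x
        ... | no new = inj₂ (record
          { focus = l at zero ++ focus F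
          ; line = line′
          ; active = λ
            { zero → active-++ˡ l (constLine (focus F)) l-active
            ; (suc i) → active-++ˡ l (line F i) l-active }
          ; focusing = λ
            { zero → ++-const-at zero
            ; (suc i) → trans (++-at l (line F i) zero) (cong (l at zero ++_) (focusing F i)) }
          ; colour = colour′
          ; coloured = λ
            { zero x → trans (cong χ (++-const-at (suc x))) (l-indep x (focus F))
            ; (suc i) x → trans (cong χ (++-at l (line F i) (suc x)))
                                (trans (l-indep x (line F i at suc x)) (coloured F i x)) }
          ; distinct = distinct′ })
          where
          ++-const-at : ∀ x → (l ++ constLine (focus F)) at x ≡ l at x ++ focus F
          ++-const-at x = trans (++-at l (constLine (focus F)) x) (cong (l at x ++_) (constLine-at (focus F) x))

          line′ : Fin (suc s) → Line (suc (suc k)) (M + N)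
          line′ zero    = l ++ constLine (focus F)
          line′ (suc i) = l ++ line F i

          colour′ : Fin (suc s) → Fin r
          colour′ zero    = χ₂ (focus F)
          colour′ (suc i) = colour F i

          distinct′ : ∀ i j → colour′ i ≡ colour′ j → i ≡ j
          distinct′ zero    zero    eq = refl
          distinct′ zero    (suc j) eq = ⊥-elim (new (j , sym eq))
          distinct′ (suc i) zero    eq = ⊥-elim (new (i , eq))
          distinct′ (suc i) (suc j) eq = cong suc (distinct F i j eq)

  hales-jewett-step : HalesJewett (suc (suc k))
  hales-jewett-step r with focused r (suc r)
  ... | N , foc = N , λ χ → conclude (foc χ)
    where
    conclude : ∀ {χ : Vec (Fin (suc (suc k))) N → Fin r} → MonoLine χ ⊎ Focused χ (suc r) → MonoLine χ
    conclude (inj₁ m) = m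
    conclude (inj₂ F) with pigeonhole (ℕₚ.n<1+n r) (colour F)
    ... | i , j , i<j , eq = ⊥-elim (ℕₚ.<-irrefl (cong Fin.toℕ (distinct F i j eq)) i<j)

hales-jewett : ∀ k → HalesJewett k
hales-jewett zero          r = 1 , λ χ → nothing ∷ [] , (zero , refl) , λ ()
hales-jewett (suc zero)    r = 1 , λ χ → nothing ∷ [] , (zero , refl) , λ { zero zero → refl }
hales-jewett (suc (suc k)) r = hales-jewett-step (hales-jewett (suc k)) r

-- The number of colours is positive so that a colour exists for the empty alphabet.
hales-jewett-colour : ∀ k r → ∃ λ N → ∀ (χ : Vec (Fin k) N → Fin (suc r)) →
  Σ (Line k N) λ l → Active l × Σ (Fin (suc r)) λ c → ∀ x → χ (l at x) ≡ c
hales-jewett-colour k r with hales-jewett k (suc r)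
... | N , hj = N , λ χ → pick k χ (hj χ)
  where
  pick : ∀ k (χ : Vec (Fin k) N → Fin (suc r)) → MonoLine χ →
         Σ (Line k N) λ l → Active l × Σ (Fin (suc r)) λ c → ∀ x → χ (l at x) ≡ c
  pick zero    χ (l , act , mono) = l , act , zero , λ ()
  pick (suc k) χ (l , act , mono) = l , act , χ (l at zero) , λ x → mono x zero

-- Ramsey's theorem

infix 4 _⊑_

-- a ⊑ b is the type of strictly increasing maps Fin a → Fin b.
data _⊑_ : ℕ → ℕ → Set where
  stop : 0 ⊑ 0
  skip : ∀ {a b} → a ⊑ b → a ⊑ suc b
  keep : ∀ {a b} → a ⊑ b → suc a ⊑ suc b

⟦_⟧ : ∀ {a b} → a ⊑ b → Fin a → Fin b
⟦ skip e ⟧ i       = suc (⟦ e ⟧ i)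
⟦ keep e ⟧ zero    = zero
⟦ keep e ⟧ (suc i) = suc (⟦ e ⟧ i)

infixr 9 _⊙_

_⊙_ : ∀ {a b c} → a ⊑ b → b ⊑ c → a ⊑ c
g      ⊙ stop   = g
g      ⊙ skip e = skip (g ⊙ e)
skip g ⊙ keep e = skip (g ⊙ e)
keep g ⊙ keep e = keep (g ⊙ e)

⟦⟧-⊙ : ∀ {a b c} (g : a ⊑ b) (e : b ⊑ c) i → ⟦ g ⊙ e ⟧ i ≡ ⟦ e ⟧ (⟦ g ⟧ i)
⟦⟧-⊙ stop     stop     ()
⟦⟧-⊙ g        (skip e) i       = cong suc (⟦⟧-⊙ g e i)
⟦⟧-⊙ (skip g) (keep e) i       = cong suc (⟦⟧-⊙ g e i)
⟦⟧-⊙ (keep g) (keep e) zero    = refl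
⟦⟧-⊙ (keep g) (keep e) (suc i) = cong suc (⟦⟧-⊙ g e i)

⊙-assoc : ∀ {a b c d} (f : a ⊑ b) (g : b ⊑ c) (h : c ⊑ d) → f ⊙ (g ⊙ h) ≡ (f ⊙ g) ⊙ h
⊙-assoc f        g        stop     = refl
⊙-assoc f        g        (skip h) = cong skip (⊙-assoc f g h)
⊙-assoc f        (skip g) (keep h) = cong skip (⊙-assoc f g h)
⊙-assoc (skip f) (keep g) (keep h) = cong skip (⊙-assoc f g h)
⊙-assoc (keep f) (keep g) (keep h) = cong keep (⊙-assoc f g h)

⟦⟧-mono : ∀ {a b} (e : a ⊑ b) {i j} → i Fin.< j → ⟦ e ⟧ i Fin.< ⟦ e ⟧ j
⟦⟧-mono (skip e) i<j = s≤s (⟦⟧-mono e i<j)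
⟦⟧-mono (keep e) {zero}  {suc j} _         = s≤s z≤n
⟦⟧-mono (keep e) {suc i} {suc j} (s≤s i<j) = s≤s (⟦⟧-mono e i<j)

⟦⟧-injective : ∀ {a b} (e : a ⊑ b) {i j} → ⟦ e ⟧ i ≡ ⟦ e ⟧ j → i ≡ j
⟦⟧-injective (skip e) eq = ⟦⟧-injective e (Finₚ.suc-injective eq)
⟦⟧-injective (keep e) {zero}  {zero}  eq = refl
⟦⟧-injective (keep e) {suc i} {suc j} eq = cong suc (⟦⟧-injective e (Finₚ.suc-injective eq))

⊑-empty : ∀ {b} → 0 ⊑ b
⊑-empty {zero}  = stop
⊑-empty {suc b} = skip ⊑-empty

⊑-empty-unique : ∀ {b} (e : 0 ⊑ b) → e ≡ ⊑-empty
⊑-empty-unique stop     = refl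
⊑-empty-unique (skip e) = cong skip (⊑-empty-unique e)

⊑-refl : ∀ {b} → b ⊑ b
⊑-refl {zero}  = stop
⊑-refl {suc b} = keep ⊑-refl

fromIncreasing : ∀ {a b} (f : Fin a → Fin b) → (∀ {i j} → i Fin.< j → f i Fin.< f j) →
                 Σ (a ⊑ b) λ e → ∀ i → ⟦ e ⟧ i ≡ f i
fromIncreasing {zero} f mono = ⊑-empty , λ ()
fromIncreasing {suc a} {zero} f mono with f zero
... | ()
fromIncreasing {suc a} {suc b} f mono with f zero in eq
... | zero = keep (proj₁ rec) , λ { zero → sym eq ; (suc i) → trans (cong suc (proj₂ rec i)) (sym (proj₂ (pos i))) }
  where
  pos : ∀ i → ∃ λ j → f (suc i) ≡ suc j
  pos i with f (suc i) | mono {zero} {suc i} (s≤s z≤n)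
  ... | zero  | lt rewrite eq = ⊥-elim (ℕₚ.n≮0 lt)
  ... | suc j | _ = j , refl
  rec = fromIncreasing (proj₁ ∘ pos) λ {i} {j} i<j →
    ℕ.s≤s⁻¹ (subst₂ Fin._<_ (proj₂ (pos i)) (proj₂ (pos j)) (mono (s≤s i<j)))
... | suc k = skip (proj₁ rec) , λ i → trans (cong suc (proj₂ rec i)) (sym (proj₂ (pos i)))
  where
  pos : ∀ i → ∃ λ j → f i ≡ suc j
  pos zero = k , eq
  pos (suc i) with f (suc i) | mono {zero} {suc i} (s≤s z≤n)
  ... | zero  | lt = ⊥-elim (ℕₚ.n≮0 lt)
  ... | suc j | _ = j , refl
  rec = fromIncreasing (proj₁ ∘ pos) λ {i} {j} i<j →
    ℕ.s≤s⁻¹ (subst₂ Fin._<_ (proj₂ (pos i)) (proj₂ (pos j)) (mono i<j))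

split : ∀ n b c → b + c ℕ.≤ n → (P : Fin n → Bool) →
        (Σ (b ⊑ n) λ h → ∀ i → P (⟦ h ⟧ i) ≡ true) ⊎ (Σ (c ⊑ n) λ h → ∀ i → P (⟦ h ⟧ i) ≡ false)
split n zero    c       _    P = inj₁ (⊑-empty , λ ())
split n (suc b) zero    _    P = inj₂ (⊑-empty , λ ())
split (suc n) (suc b) (suc c) (s≤s le) P with P zero in eq
... | true with split n b (suc c) le (P ∘ suc)
...   | inj₁ (h , all) = inj₁ (keep h , λ { zero → eq ; (suc i) → all i })
...   | inj₂ (h , all) = inj₂ (skip h , all)
split (suc n) (suc b) (suc c) (s≤s le) P | false
  with split n (suc b) c (subst (ℕ._≤ n) (ℕₚ.+-suc b c) le) (P ∘ suc)
...   | inj₁ (h , all) = inj₁ (skip h , all)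
...   | inj₂ (h , all) = inj₂ (keep h , λ { zero → eq ; (suc i) → all i })

-- One colour is split off at a time: among `b + m` points either `b` have colour `zero`, or `m`
-- avoid it and one colour fewer remains.
monochromatic-subset : ∀ r b → ∃ λ m → ∀ (d : Fin m → Fin (suc r)) →
  Σ (b ⊑ m) λ h → Σ (Fin (suc r)) λ c → ∀ i → d (⟦ h ⟧ i) ≡ c
monochromatic-subset zero b = b , λ d → ⊑-refl , zero , λ i → fin1 (d (⟦ ⊑-refl ⟧ i))
  where
  fin1 : (x : Fin 1) → x ≡ zero
  fin1 zero = refl
monochromatic-subset (suc r) b with monochromatic-subset r b
... | m , ih = b + m , λ d → go d (split (b + m) b m ℕₚ.≤-refl (λ i → does (d i Finₚ.≟ zero)))
  where
  true⇒zero : (x : Fin (suc (suc r))) → does (x Finₚ.≟ zero) ≡ true → x ≡ zero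
  true⇒zero zero _ = refl
  pred′ : (x : Fin (suc (suc r))) → does (x Finₚ.≟ zero) ≡ false → ∃ λ y → x ≡ suc y
  pred′ (suc y) _ = y , refl
  go : ∀ d → _ → Σ (b ⊑ (b + m)) λ h → Σ (Fin (suc (suc r))) λ c → ∀ i → d (⟦ h ⟧ i) ≡ c
  go d (inj₁ (h , all)) = h , zero , λ i → true⇒zero _ (all i)
  go d (inj₂ (h , all)) with ih (λ i → proj₁ (pred′ (d (⟦ h ⟧ i)) (all i)))
  ... | h′ , c , const = h′ ⊙ h , suc c , λ i →
    trans (cong d (⟦⟧-⊙ h′ h i)) (trans (proj₂ (pred′ (d (⟦ h ⟧ (⟦ h′ ⟧ i))) (all (⟦ h′ ⟧ i)))) (cong suc (const i)))

Ramsey : ℕ → Set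
Ramsey a = ∀ r b → ∃ λ p → ∀ (χ : a ⊑ p → Fin (suc r)) →
  Σ (b ⊑ p) λ e → Σ (Fin (suc r)) λ c → ∀ g → χ (g ⊙ e) ≡ c

-- The first vertex is kept and Ramsey's theorem for `a` is applied to the maps that start there.
-- The induction continues inside the homogeneous set, so each vertex fixes the colour of all maps
-- that it starts.
min-homogeneous : ∀ {a} → Ramsey a → ∀ r m → ∃ λ p → ∀ (χ : suc a ⊑ p → Fin (suc r)) →
  Σ (m ⊑ p) λ e → Σ (Fin m → Fin (suc r)) λ d → ∀ g → χ (g ⊙ e) ≡ d (⟦ g ⟧ zero)
min-homogeneous ram r zero = 0 , λ χ → stop , (λ ()) , λ ()
min-homogeneous {a} ram r (suc m) with min-homogeneous ram r m
... | p , ih with ram r p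
... | p′ , ramp = suc p′ , go
  where
  go : ∀ (χ : suc a ⊑ suc p′ → Fin (suc r)) → Σ (suc m ⊑ suc p′) λ e →
       Σ (Fin (suc m) → Fin (suc r)) λ d → ∀ g → χ (g ⊙ e) ≡ d (⟦ g ⟧ zero)
  go χ with ramp (χ ∘ keep)
  ... | e₁ , c , hom with ih (λ g → χ (skip (g ⊙ e₁)))
  ... | e₂ , d , pre = keep (e₂ ⊙ e₁) , d′ , λ
    { (keep g) → trans (cong (χ ∘ keep) (⊙-assoc g e₂ e₁)) (hom (g ⊙ e₂))
    ; (skip g) → trans (cong (χ ∘ skip) (⊙-assoc g e₂ e₁)) (pre g) }
    where
    d′ : Fin (suc m) → Fin (suc r)
    d′ zero    = c
    d′ (suc i) = d i

ramsey : ∀ a → Ramsey a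
ramsey zero r b = b , λ χ → ⊑-refl , χ ⊑-empty , λ g → cong χ (⊑-empty-unique (g ⊙ ⊑-refl))
ramsey (suc a) r b with monochromatic-subset r b
... | m , mono with min-homogeneous (ramsey a) r m
... | p , pre = p , go
  where
  go : ∀ χ → _
  go χ with pre χ
  ... | e , d , hom with mono d
  ... | h , c , const = h ⊙ e , c , λ g → trans (cong χ (⊙-assoc g h e))
    (trans (hom (g ⊙ h)) (trans (cong d (⟦⟧-⊙ g h zero)) (const (⟦ g ⟧ zero))))

-- Ordered binary relations

inverse : ∀ {a p} → a ⊑ p → Fin p → Maybe (Fin a)
inverse (skip e) zero    = nothing
inverse (skip e) (suc j) = inverse e j
inverse (keep e) zero    = just zero
inverse (keep e) (suc j) = Maybe.map suc (inverse e j)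

inverse-⟦⟧ : ∀ {a p} (e : a ⊑ p) i → inverse e (⟦ e ⟧ i) ≡ just i
inverse-⟦⟧ (skip e) i       = inverse-⟦⟧ e i
inverse-⟦⟧ (keep e) zero    = refl
inverse-⟦⟧ (keep e) (suc i) = cong (Maybe.map suc) (inverse-⟦⟧ e i)

inverse-just : ∀ {a p} (e : a ⊑ p) j {i} → inverse e j ≡ just i → ⟦ e ⟧ i ≡ j
inverse-just (skip e) (suc j) eq = cong suc (inverse-just e j eq)
inverse-just (keep e) zero    refl = refl
inverse-just (keep e) (suc j) eq with inverse e j in eq′
inverse-just (keep e) (suc j) refl | just i = cong suc (inverse-just e j eq′)

Rel : ℕ → Set
Rel a = Fin a → Fin a → Bool

-- A relation on p consecutive parts of q vertices each.
PartiteRel : ℕ → ℕ → Set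
PartiteRel p q = Fin p → Fin q → Fin p → Fin q → Bool

Preserves : ∀ {p q q′} → PartiteRel p q → PartiteRel p q′ → (Fin p → Fin q → Fin q′) → Set
Preserves G G′ f = ∀ j x j′ y → G′ j (f j x) j′ (f j′ y) ≡ G j x j′ y

CopyOver : ∀ {a p q} → Rel a → PartiteRel p q → a ⊑ p → (Fin a → Fin q) → Set
CopyOver R G α s = ∀ i i′ → G (⟦ α ⟧ i) (s i) (⟦ α ⟧ i′) (s i′) ≡ R i i′

-- The partite lemma

module Power {a p q : ℕ} (R : Rel a) (G : PartiteRel p q) (α : a ⊑ p) (N : ℕ) where

  copy? : ∀ s → Dec (CopyOver R G α s)
  copy? s = all? λ i → all? λ i′ → _ Boolₚ.≟ _

  Word : Set
  Word = Vec (Maybe (Fin q)) N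

  fromMaybeFin : Maybe (Fin q) → Fin (suc q)
  fromMaybeFin nothing  = zero
  fromMaybeFin (just x) = suc x

  toMaybeFin : Fin (suc q) → Maybe (Fin q)
  toMaybeFin zero    = nothing
  toMaybeFin (suc x) = just x

  to-from : ∀ m → toMaybeFin (fromMaybeFin m) ≡ m
  to-from nothing  = refl
  to-from (just x) = refl

  encode : Word → Fin (suc q ^ N)
  encode w = funToFin (fromMaybeFin ∘ lookup w)

  decode : Fin (suc q ^ N) → Fin N → Maybe (Fin q)
  decode z n = toMaybeFin (finToFun z n)

  decode-encode : ∀ w n → decode (encode w) n ≡ lookup w n
  decode-encode w n = trans (cong toMaybeFin (finToFun-funToFin (fromMaybeFin ∘ lookup w) n)) (to-from (lookup w n))

  -- The reference value against which coordinates are compared. Off the range of `α` it is a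
  -- convention; `true` would serve as well as `false`.
  transported : Fin p → Fin p → Bool
  transported j j′ with inverse α j | inverse α j′
  ... | just i  | just i′ = R i i′
  ... | just _  | nothing = false
  ... | nothing | _       = false

  local : Fin p → Maybe (Fin q) → Fin p → Maybe (Fin q) → Bool
  local j (just x) j′ (just y) = G j x j′ y
  local j (just x) j′ nothing  = transported j j′
  local j nothing  j′ _        = transported j j′

  -- A coordinate where one of the words is undefined agrees with R by convention.
  -- So a pair of words deviates from R iff it does so at some coordinate.
  power : PartiteRel p (suc q ^ N)
  power j u j′ v =
    if does (all? λ n → local j (decode u n) j′ (decode v n) Boolₚ.≟ transported j j′)
    then transported j j′ else not (transported j j′)

  -- Letters are codes of maps Fin a → Fin q.
  -- Those that are not copies of R are undefined everywhere.
  value : Fin (q ^ a) → Fin p → Maybe (Fin q)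
  value k j with copy? (finToFun k)
  ... | yes _ = Maybe.map (finToFun k) (inverse α j)
  ... | no  _ = nothing

  -- Fixed coordinates of a line never deviate from the reference: on a letter that is a copy, `G`
  -- agrees with `R`, and in every other case one of the entries is undefined.
  value-local : ∀ k j j′ → local j (value k j) j′ (value k j′) ≡ transported j j′
  value-local k j j′ with copy? (finToFun k)
  ... | no _ = refl
  ... | yes copy with inverse α j in eq | inverse α j′ in eq′
  ...   | just i  | just i′ rewrite sym (inverse-just α j eq) | sym (inverse-just α j′ eq′) = copy i i′
  ...   | just _  | nothing rewrite eq | eq′ = refl
  ...   | nothing | _       rewrite eq = refl

  value-copy : ∀ s → CopyOver R G α s → ∀ i → value (funToFin s) (⟦ α ⟧ i) ≡ just (s i)
  value-copy s copy i with copy? (finToFun (funToFin s))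
  ... | yes _ rewrite inverse-⟦⟧ α i = cong just (finToFun-funToFin s i)
  ... | no ¬copy = ⊥-elim (¬copy λ i i′ →
    trans (cong₂ (λ x y → G (⟦ α ⟧ i) x (⟦ α ⟧ i′) y) (finToFun-funToFin s i) (finToFun-funToFin s i′)) (copy i i′))

  fill : Fin p → Fin q → Maybe (Fin (q ^ a)) → Maybe (Fin q)
  fill j x (just k) = value k j
  fill j x nothing  = just x

  along : Line (q ^ a) N → Fin p → Fin q → Fin (suc q ^ N)
  along l j x = encode (Vec.map (fill j x) l)

  -- An active coordinate shows `G` itself. If `G` agrees with the reference, so do all active
  -- coordinates, and the fixed ones agree by `value-local`. If `G` deviates, the active coordinate
  -- `n₀` reveals it, and a Boolean that deviates is the negation.
  along-preserves : ∀ l → Active l → Preserves G power (along l)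
  along-preserves l (n₀ , star) j x j′ y = conclude
    (all? λ n → local j (decode (along l j x) n) j′ (decode (along l j′ y) n) Boolₚ.≟ transported j j′)
    where
    decode-along : ∀ j x n → decode (along l j x) n ≡ fill j x (lookup l n)
    decode-along j x n = trans (decode-encode (Vec.map (fill j x) l) n) (Vecₚ.lookup-map n (fill j x) l)

    loc : ∀ n → local j (decode (along l j x) n) j′ (decode (along l j′ y) n)
              ≡ local j (fill j x (lookup l n)) j′ (fill j′ y (lookup l n))
    loc n = cong₂ (λ u v → local j u j′ v) (decode-along j x n) (decode-along j′ y n)

    flip : ∀ {b c} → ¬ c ≡ b → not b ≡ c
    flip {true}  {true}  ne = ⊥-elim (ne refl)
    flip {true}  {false} ne = refl
    flip {false} {true}  ne = refl
    flip {false} {false} ne = ⊥-elim (ne refl)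

    conclude : (d : Dec (∀ n → local j (decode (along l j x) n) j′ (decode (along l j′ y) n) ≡ transported j j′)) →
               (if does d then transported j j′ else not (transported j j′)) ≡ G j x j′ y
    conclude (yes all) = trans (sym (all n₀)) (trans (loc n₀)
      (cong (λ m → local j (fill j x m) j′ (fill j′ y m)) star))
    conclude (no ¬all) = flip λ G≡ → ¬all λ n → trans (loc n) (agree G≡ (lookup l n))
      where
      agree : G j x j′ y ≡ transported j j′ → ∀ m → local j (fill j x m) j′ (fill j′ y m) ≡ transported j j′
      agree G≡ nothing  = G≡
      agree G≡ (just k) = value-local k j j′

  -- On a copy `s`, the vertex put in an active coordinate is the one that the letter coding `s` has
  -- there. So the image of the copy is read off from the single word `l at funToFin s`, a point of
  -- the line.
  along-copy : ∀ l s → CopyOver R G α s → ∀ i →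
    along l (⟦ α ⟧ i) (s i) ≡ encode (Vec.map (λ k → value k (⟦ α ⟧ i)) (l at funToFin s))
  along-copy l s copy i = cong encode (trans (Vecₚ.map-cong eq l) (Vecₚ.map-∘ (λ k → value k (⟦ α ⟧ i)) _ l))
    where
    eq : ∀ m → fill (⟦ α ⟧ i) (s i) m ≡ value (fromMaybe (funToFin s) m) (⟦ α ⟧ i)
    eq nothing  = sym (value-copy s copy i)
    eq (just k) = refl

Homogeneous : ∀ {a p q q′ r} → Rel a → PartiteRel p q → a ⊑ p → (Fin p → Fin q → Fin q′) →
              (Vec (Fin q′) a → Fin r) → Set
Homogeneous {r = r} R G α f χ = Σ (Fin r) λ c → ∀ s → CopyOver R G α s →
  χ (tabulate λ i → f (⟦ α ⟧ i) (s i)) ≡ c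

partite-lemma : ∀ {a p q} r (R : Rel a) (G : PartiteRel p q) (α : a ⊑ p) →
  Σ ℕ λ q′ → Σ (PartiteRel p q′) λ G′ → ∀ (χ : Vec (Fin q′) a → Fin (suc r)) →
  Σ (Fin p → Fin q → Fin q′) λ f → Preserves G G′ f × Homogeneous R G α f χ
partite-lemma {a} {p} {q} r R G α with hales-jewett-colour (q ^ a) r
... | N , hj = suc q ^ N , power , go
  where
  open Power R G α N
  go : ∀ χ → _
  -- A word over the letters names one vertex in each chosen part, hence an `a`-tuple that `χ`
  -- colours.
  go χ with hj (λ w → χ (tabulate λ i → encode (Vec.map (λ k → value k (⟦ α ⟧ i)) w)))
  ... | l , act , c , mono = along l , along-preserves l act , c , λ s copy →
    trans (cong χ (Vecₚ.tabulate-cong (along-copy l s copy))) (mono (funToFin s))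

-- The systems are built upwards, one choice of parts each, and the colouring is resolved downwards:
-- `f₂` is found first and the colouring for `α` is pulled back along it. The choices in the tail
-- stay homogeneous because `f₁` maps copies to copies.
partite-construction : ∀ {a p q} r (R : Rel a) (G : PartiteRel p q) (αs : List (a ⊑ p)) →
  Σ ℕ λ q′ → Σ (PartiteRel p q′) λ G′ → ∀ (χ : a ⊑ p → Vec (Fin q′) a → Fin (suc r)) →
  Σ (Fin p → Fin q → Fin q′) λ f → Preserves G G′ f × (∀ {α} → α ∈ αs → Homogeneous R G α f (χ α))
partite-construction {q = q} r R G [] =
  q , G , λ χ → (λ j x → x) , (λ _ _ _ _ → refl) , λ ()
partite-construction r R G (α ∷ αs) with partite-lemma r R G α
... | q₁ , G₁ , step with partite-construction r R G₁ αs
... | q₂ , G₂ , rec = q₂ , G₂ , go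
  where
  go : ∀ χ → _
  go χ with rec χ
  ... | f₂ , pres₂ , hom₂
    with step (λ s → χ α (tabulate λ i → f₂ (⟦ α ⟧ i) (lookup s i)))
  ... | f₁ , pres₁ , c₁ , hom₁ = (λ j x → f₂ j (f₁ j x)) ,
    (λ j x j′ y → trans (pres₂ j _ j′ _) (pres₁ j x j′ y)) , λ
    { (here refl) → c₁ , λ s copy → trans
        (cong (χ α) (Vecₚ.tabulate-cong λ i → cong (f₂ (⟦ α ⟧ i)) (sym (Vecₚ.lookup∘tabulate _ i))))
        (hom₁ s copy)
    ; (there α∈) → proj₁ (hom₂ α∈) , λ s copy →
        proj₂ (hom₂ α∈) _ λ i i′ → trans (pres₁ _ _ _ _) (copy i i′) }

all⊑ : ∀ a p → List (a ⊑ p)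
all⊑ zero    zero    = stop ∷ []
all⊑ (suc a) zero    = []
all⊑ zero    (suc p) = List.map skip (all⊑ zero p)
all⊑ (suc a) (suc p) = List.map skip (all⊑ (suc a) p) List.++ List.map keep (all⊑ a p)

all⊑-complete : ∀ {a p} (e : a ⊑ p) → e ∈ all⊑ a p
all⊑-complete stop = here refl
all⊑-complete {zero}  (skip e) = ∈-map⁺ skip (all⊑-complete e)
all⊑-complete {suc a} (skip e) = ∈-++⁺ˡ (∈-map⁺ skip (all⊑-complete e))
all⊑-complete {suc a} {suc p} (keep e) = ∈-++⁺ʳ (List.map skip (all⊑ (suc a) p)) (∈-map⁺ keep (all⊑-complete e))

-- Vertices of every part are codes of maps e : Fin b → Fin p.
-- The pairs (e i , e) form a copy of R for each injective e.
sheaf : ∀ {b} → Rel b → ∀ p → PartiteRel p (p ^ b)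
sheaf R p j u j′ v = does (any? λ i → any? λ i′ →
  (finToFun u i Finₚ.≟ j) ×-dec (finToFun v i′ Finₚ.≟ j′) ×-dec (R i i′ Boolₚ.≟ true))

does-≡ : ∀ {P : Set} (d : Dec P) {b} → (P → b ≡ true) → (b ≡ true → P) → does d ≡ b
does-≡ (yes p) to from = sym (to p)
does-≡ (no ¬p) {true}  to from = ⊥-elim (¬p (from refl))
does-≡ (no ¬p) {false} to from = refl

-- All vertices carry the same code, that of `e`, and injectivity of `⟦ e ⟧` makes the pair of
-- indices behind an edge unique.
sheaf-copy : ∀ {b p} (R : Rel b) (e : b ⊑ p) → CopyOver R (sheaf R p) e (λ _ → funToFin ⟦ e ⟧)
sheaf-copy {b} {p} R e i i′ = does-≡ (any? _)
  (λ { (k , k′ , eq , eq′ , Rkk′) → trans (cong₂ R (same eq) (same eq′)) Rkk′ })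
  (λ Rii′ → i , i′ , finToFun-funToFin ⟦ e ⟧ i , finToFun-funToFin ⟦ e ⟧ i′ , Rii′)
  where
  same : ∀ {k i} → finToFun (funToFin ⟦ e ⟧) k ≡ ⟦ e ⟧ i → i ≡ k
  same {k} eq = sym (⟦⟧-injective e (trans (sym (finToFun-funToFin ⟦ e ⟧ k)) eq))

-- Nešetřil–Rödl theorem for linearly ordered sets with one binary relation.
ordered-relation-ramsey : ∀ r {a b} (R : Rel a) (S : Rel b) →
  Σ ℕ λ p → Σ ℕ λ q → Σ (PartiteRel p q) λ G → ∀ (χ : a ⊑ p → Vec (Fin q) a → Fin (suc r)) →
  Σ (b ⊑ p) λ e → Σ (Fin b → Fin q) λ t → CopyOver S G e t ×
  Σ (Fin (suc r)) λ c → ∀ (g : a ⊑ b) → (∀ i i′ → S (⟦ g ⟧ i) (⟦ g ⟧ i′) ≡ R i i′) →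
  χ (g ⊙ e) (tabulate (t ∘ ⟦ g ⟧)) ≡ c
ordered-relation-ramsey r {a} {b} R S with ramsey a r b
... | p , ram with partite-construction r R (sheaf S p) (all⊑ a p)
... | q , G , construct = p , q , G , go
  where
  go : ∀ χ → _
  go χ with construct χ
  -- Homogeneity gives each choice of parts one colour, which is a colouring of the `a`-subsets of
  -- the `p` parts; Ramsey's theorem makes it constant below some `e`.
  ... | f , pres , hom with ram (λ α → proj₁ (hom (all⊑-complete α)))
  ... | e , c , const = e , t , copy , c , λ g emb →
    trans (cong (χ (g ⊙ e)) (Vecₚ.tabulate-cong λ i → cong (λ j → f j (funToFin ⟦ e ⟧)) (sym (⟦⟧-⊙ g e i))))
    (trans (proj₂ (hom (all⊑-complete (g ⊙ e))) (λ _ → funToFin ⟦ e ⟧) (λ i i′ →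
       trans (cong₂ (λ j j′ → sheaf S p j (funToFin ⟦ e ⟧) j′ (funToFin ⟦ e ⟧)) (⟦⟧-⊙ g e i) (⟦⟧-⊙ g e i′))
             (trans (sheaf-copy S e (⟦ g ⟧ i) (⟦ g ⟧ i′)) (emb i i′))))
      (const g))
    where
    t : Fin b → Fin q
    t i = f (⟦ e ⟧ i) (funToFin ⟦ e ⟧)
    copy : CopyOver S G e t
    copy i i′ = trans (pres _ _ _ _) (sheaf-copy S e i i′)

-- Ordered enumeration of a finite set

record LinearOrder {X : Set} (_<_ : X → X → Set) : Set where
  field
    irrefl  : ∀ {x} → ¬ x < x
    trans<  : ∀ {x y z} → x < y → y < z → x < z
    compare : ∀ x y → x < y ⊎ x ≡ y ⊎ y < x

module Enumeration {X : Set} {_<_ : X → X → Set} (order : LinearOrder _<_) where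
  open LinearOrder order

  -- Repetitions are dropped: all points of a block yield the same marker, which has to be listed
  -- once for the enumeration to be strictly increasing.
  insert : X → List X → List X
  insert x [] = x ∷ []
  insert x (y ∷ ys) with compare x y
  ... | inj₁ _        = x ∷ y ∷ ys
  ... | inj₂ (inj₁ _) = y ∷ ys
  ... | inj₂ (inj₂ _) = y ∷ insert x ys

  ∈-insert : ∀ x ys → x ∈ insert x ys
  ∈-insert x [] = here refl
  ∈-insert x (y ∷ ys) with compare x y
  ... | inj₁ _          = here refl
  ... | inj₂ (inj₁ x≡y) = here x≡y
  ... | inj₂ (inj₂ _)   = there (∈-insert x ys)

  ∈-insert⁺ : ∀ {z} x ys → z ∈ ys → z ∈ insert x ys
  ∈-insert⁺ x (y ∷ ys) z∈ with compare x y
  ... | inj₁ _        = there z∈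
  ... | inj₂ (inj₁ _) = z∈
  ∈-insert⁺ x (y ∷ ys) (here z≡y) | inj₂ (inj₂ _) = here z≡y
  ∈-insert⁺ x (y ∷ ys) (there z∈) | inj₂ (inj₂ _) = there (∈-insert⁺ x ys z∈)

  ∈-insert⁻ : ∀ {z} x ys → z ∈ insert x ys → z ≡ x ⊎ z ∈ ys
  ∈-insert⁻ x [] (here z≡x) = inj₁ z≡x
  ∈-insert⁻ x (y ∷ ys) z∈ with compare x y
  ∈-insert⁻ x (y ∷ ys) (here z≡x) | inj₁ _ = inj₁ z≡x
  ∈-insert⁻ x (y ∷ ys) (there z∈) | inj₁ _ = inj₂ z∈
  ... | inj₂ (inj₁ _) = inj₂ z∈
  ∈-insert⁻ x (y ∷ ys) (here z≡y) | inj₂ (inj₂ _) = inj₂ (here z≡y)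
  ∈-insert⁻ x (y ∷ ys) (there z∈) | inj₂ (inj₂ _) with ∈-insert⁻ x ys z∈
  ... | inj₁ z≡x = inj₁ z≡x
  ... | inj₂ z∈′ = inj₂ (there z∈′)

  insert-sorted : ∀ x ys → AllPairs _<_ ys → AllPairs _<_ (insert x ys)
  insert-sorted x [] [] = [] ∷ []
  insert-sorted x (y ∷ ys) (y<ys ∷ sorted) with compare x y
  ... | inj₁ x<y      = (x<y ∷ All.map (trans< x<y) y<ys) ∷ y<ys ∷ sorted
  ... | inj₂ (inj₁ _) = y<ys ∷ sorted
  ... | inj₂ (inj₂ y<x) = All.tabulate below ∷ insert-sorted x ys sorted
    where
    below : ∀ {z} → z ∈ insert x ys → y < z
    below z∈ with ∈-insert⁻ x ys z∈
    ... | inj₁ refl = y<x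
    ... | inj₂ z∈′  = All.lookup y<ys z∈′

  sort : List X → List X
  sort = List.foldr insert []

  sort-sorted : ∀ xs → AllPairs _<_ (sort xs)
  sort-sorted []       = []
  sort-sorted (x ∷ xs) = insert-sorted x (sort xs) (sort-sorted xs)

  ∈-sort⁺ : ∀ {z xs} → z ∈ xs → z ∈ sort xs
  ∈-sort⁺ {xs = x ∷ xs} (here refl) = ∈-insert x (sort xs)
  ∈-sort⁺ {xs = x ∷ xs} (there z∈)  = ∈-insert⁺ x (sort xs) (∈-sort⁺ z∈)

  ∈-sort⁻ : ∀ {z} xs → z ∈ sort xs → z ∈ xs
  ∈-sort⁻ (x ∷ xs) z∈ with ∈-insert⁻ x (sort xs) z∈
  ... | inj₁ z≡x = here z≡x
  ... | inj₂ z∈′ = there (∈-sort⁻ xs z∈′)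

  lookup-increasing : ∀ {xs} → AllPairs _<_ xs → ∀ {i j} → i Fin.< j → List.lookup xs i < List.lookup xs j
  lookup-increasing (x<xs ∷ _)   {zero}  {suc j} _         = All.lookup x<xs (∈-lookup j)
  lookup-increasing (_ ∷ sorted) {suc i} {suc j} (s≤s i<j) = lookup-increasing sorted i<j

-- Rational labels, and images of finite maps as subsets

rational : ∀ {p} → Fin p → ℚ
rational i = mkℚ (+ Fin.toℕ i) 0 (Coprimality.sym (Coprimality.1-coprimeTo (Fin.toℕ i)))

rational-mono : ∀ {p} {i j : Fin p} → i Fin.< j → rational i ℚ.< rational j
rational-mono {i = i} {j} i<j = *<*
  (subst₂ ℤ._<_ (sym (ℤₚ.*-identityʳ (+ Fin.toℕ i))) (sym (ℤₚ.*-identityʳ (+ Fin.toℕ j))) (+<+ i<j))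

rational-injective : ∀ {p} {i j : Fin p} → rational i ≡ rational j → i ≡ j
rational-injective eq = Finₚ.toℕ-injective (ℤₚ.+-injective (cong ℚ.ℚ.numerator eq))

does⇒ : ∀ {P : Set} (d : Dec P) → does d ≡ true → P
does⇒ (yes p) _ = p

⇒does : ∀ {P : Set} (d : Dec P) → P → does d ≡ true
⇒does (yes _) _ = refl
⇒does (no ¬p) p = ⊥-elim (¬p p)

image : ∀ {a c} → (Fin a → Fin c) → Subset c
image f = tabulate λ z → does (any? λ x → f x Finₚ.≟ z)

image-cong : ∀ {a c} {f g : Fin a → Fin c} → (∀ x → f x ≡ g x) → image f ≡ image g
image-cong {f = f} {g} f≗g = Vecₚ.tabulate-cong λ z → does-≡ (any? _)
  (λ { (x , fx≡z) → ⇒does (any? _) (x , trans (sym (f≗g x)) fx≡z) })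
  (λ t → let (x , gx≡z) = does⇒ (any? λ x → g x Finₚ.≟ z) t in x , trans (f≗g x) gx≡z)

∈-image : ∀ {a c} (f : Fin a → Fin c) z → (z Subset.∈ image f) ⇔ (∃ λ x → f x ≡ z)
∈-image f z =
  (λ z∈ → does⇒ (any? _) (trans (sym (Vecₚ.lookup∘tabulate _ z)) (Vecₚ.[]=⇒lookup z∈))) ,
  (λ hit → Vecₚ.lookup⇒[]= z (image f) (trans (Vecₚ.lookup∘tabulate _ z) (⇒does (any? _) hit)))

image-unique : ∀ {a c} (f : Fin a → Fin c) S → (∀ z → (z Subset.∈ S) ⇔ (∃ λ x → f x ≡ z)) → S ≡ image f
image-unique f S char = Subsetₚ.⊆-antisym
  (λ {z} z∈ → proj₂ (∈-image f z) (proj₁ (char z) z∈))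
  (λ {z} z∈ → proj₂ (char z) (proj₁ (∈-image f z) z∈))

-- Reduction to ordered binary relations

-- The conditions on order and edges assume that `x` is below `y`, that `j` is below `j′` and that
-- `G` records `E T x y`. Two distinct points of one block satisfy all this, in one of the two
-- orders, in any copy of a marked structure. The points listed here form every block of the target.
record Realisation {k} (T : Str k) {p q} (G : PartiteRel p q) : Set where
  field
    number          : ℕ
    point           : Fin number → Carrier T
    point-injective : ∀ {m n} → point m ≡ point n → m ≡ n
    place           : Fin p → Fin q → Carrier T → Fin number
    place-Lt : ∀ {j u x j′ v y} → Lt T x y → j Fin.< j′ → (G j u j′ v ≡ true) ⇔ E T x y →
               Lt T (point (place j u x)) (point (place j′ v y))
    place-E  : ∀ {j u x j′ v y} → Lt T x y → j Fin.< j′ → (G j u j′ v ≡ true) ⇔ E T x y →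
               E T (point (place j u x)) (point (place j′ v y)) ⇔ E T x y
    place-P  : ∀ i j u x → P T i (point (place j u x)) ⇔ P T i x
    place-type : ∀ {j u x y} → (∀ i → P T i x ⇔ P T i y) → place j u x ≡ place j u y

record OrderedTournament {k} (T : Str k) : Set where
  field
    order   : LinearOrder (Lt T)
    E-total : ∀ {x y} → Lt T x y → E T x y ⊎ E T y x
    E-asym  : ∀ {x y} → E T x y → ¬ E T y x

⇔-trans : ∀ {X Y Z} → X ⇔ Y → Y ⇔ Z → X ⇔ Z
⇔-trans (f , f′) (g , g′) = g ∘ f , f′ ∘ g′

⇔-sym : ∀ {X Y} → X ⇔ Y → Y ⇔ X
⇔-sym (f , f′) = f′ , f

module Reduction {k : ℕ} (T : Str k) (tournament : OrderedTournament T) where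
  open OrderedTournament tournament
  open LinearOrder order

  -- In a tournament the reverse edge refutes an edge, so comparability decides `E`. This lets the
  -- `Set`-valued relation of `A` be turned into a Boolean one.
  ET? : ∀ x y → Dec (E T x y)
  ET? x y with compare x y
  ... | inj₂ (inj₁ refl) = no λ e → E-asym e e
  ... | inj₁ x<y with E-total x<y
  ...   | inj₁ e  = yes e
  ...   | inj₂ e′ = no λ e → E-asym e e′
  ET? x y | inj₂ (inj₂ y<x) with E-total y<x
  ...   | inj₁ e′ = no λ e → E-asym e e′
  ...   | inj₂ e  = yes e

  -- (ρ , nothing) is the marker of the block ρ. It precedes all points of the block.
  Pt : Set
  Pt = ℚ × Maybe (Carrier T)

  data _<ₘ_ : Maybe (Carrier T) → Maybe (Carrier T) → Set where
    marker< : ∀ {x} → nothing <ₘ just x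
    point<  : ∀ {x y} → Lt T x y → just x <ₘ just y

  _<ₚ_ : Pt → Pt → Set
  (ρ , m) <ₚ (ρ′ , m′) = ρ ℚ.< ρ′ ⊎ (ρ ≡ ρ′ × m <ₘ m′)

  <ₘ-compare : ∀ m m′ → m <ₘ m′ ⊎ m ≡ m′ ⊎ m′ <ₘ m
  <ₘ-compare nothing  nothing  = inj₂ (inj₁ refl)
  <ₘ-compare nothing  (just _) = inj₁ marker<
  <ₘ-compare (just _) nothing  = inj₂ (inj₂ marker<)
  <ₘ-compare (just x) (just y) with compare x y
  ... | inj₁ x<y          = inj₁ (point< x<y)
  ... | inj₂ (inj₁ refl)  = inj₂ (inj₁ refl)
  ... | inj₂ (inj₂ y<x)   = inj₂ (inj₂ (point< y<x))

  <ₘ-trans : ∀ {m m′ m″} → m <ₘ m′ → m′ <ₘ m″ → m <ₘ m″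
  <ₘ-trans marker<     (point< _)   = marker<
  <ₘ-trans (point< lt) (point< lt′) = point< (trans< lt lt′)

  <ₚ-irrefl : ∀ {v} → ¬ v <ₚ v
  <ₚ-irrefl (inj₁ ρ<ρ)               = ℚₚ.<-irrefl refl ρ<ρ
  <ₚ-irrefl (inj₂ (_ , point< lt))   = irrefl lt

  <ₚ-trans : ∀ {u v w} → u <ₚ v → v <ₚ w → u <ₚ w
  <ₚ-trans (inj₁ lt)          (inj₁ lt′)          = inj₁ (ℚₚ.<-trans lt lt′)
  <ₚ-trans (inj₁ lt)          (inj₂ (refl , _))   = inj₁ lt
  <ₚ-trans (inj₂ (refl , _))  (inj₁ lt′)          = inj₁ lt′
  <ₚ-trans (inj₂ (refl , lt)) (inj₂ (refl , lt′)) = inj₂ (refl , <ₘ-trans lt lt′)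

  <ₚ-compare : ∀ u v → u <ₚ v ⊎ u ≡ v ⊎ v <ₚ u
  <ₚ-compare (ρ , m) (ρ′ , m′) with ℚₚ.<-cmp ρ ρ′
  ... | tri< lt _ _ = inj₁ (inj₁ lt)
  ... | tri> _ _ gt = inj₂ (inj₂ (inj₁ gt))
  ... | tri≈ _ refl _ with <ₘ-compare m m′
  ...   | inj₁ lt          = inj₁ (inj₂ (refl , lt))
  ...   | inj₂ (inj₁ refl) = inj₂ (inj₁ refl)
  ...   | inj₂ (inj₂ gt)   = inj₂ (inj₂ (inj₂ (refl , gt)))

  <ₚ-order : LinearOrder _<ₚ_
  <ₚ-order = record { irrefl = <ₚ-irrefl ; trans< = <ₚ-trans ; compare = <ₚ-compare }

  open Enumeration <ₚ-order

  -- Marking a structure of the age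

  module Marked (A : FinStr k) (ε : Emb (fin A) (Iω* T)) where

    ρ : Fin (size A) → ℚ
    ρ x = proj₁ (map ε x)

    τ : Fin (size A) → Carrier T
    τ x = proj₂ (map ε x)

    ε-injective : ∀ {x y} → ρ x ≡ ρ y → τ x ≡ τ y → x ≡ y
    ε-injective {x} {y} eq eq′ = inj ε x y (cong₂ _,_ eq eq′)

    Key : Set
    Key = Fin (size A) ⊎ Fin (size A)

    val : Key → Pt
    val (inj₁ x) = ρ x , nothing
    val (inj₂ x) = ρ x , just (τ x)

    vals : List Pt
    vals = List.tabulate (val ∘ inj₁) List.++ List.tabulate (val ∘ inj₂)

    val∈ : ∀ κ → val κ ∈ vals
    val∈ (inj₁ x) = ∈-++⁺ˡ (∈-tabulate⁺ {f = val ∘ inj₁} x)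
    val∈ (inj₂ x) = ∈-++⁺ʳ (List.tabulate (val ∘ inj₁)) (∈-tabulate⁺ {f = val ∘ inj₂} x)

    val∈⁻ : ∀ {v} → v ∈ vals → ∃ λ κ → val κ ≡ v
    val∈⁻ v∈ with ∈-++⁻ (List.tabulate (val ∘ inj₁)) v∈
    ... | inj₁ v∈₁ = let (x , eq) = ∈-tabulate⁻ v∈₁ in inj₁ x , sym eq
    ... | inj₂ v∈₂ = let (x , eq) = ∈-tabulate⁻ v∈₂ in inj₂ x , sym eq

    len : ℕ
    len = List.length (sort vals)

    sorted : Fin len → Pt
    sorted = List.lookup (sort vals)

    sorted-increasing : ∀ {i j} → i Fin.< j → sorted i <ₚ sorted j
    sorted-increasing = lookup-increasing (sort-sorted vals)

    position : Key → Fin len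
    position κ = Any.index (∈-sort⁺ (val∈ κ))

    sorted-position : ∀ κ → sorted (position κ) ≡ val κ
    sorted-position κ = sym (lookup-index (∈-sort⁺ (val∈ κ)))

    key : Fin len → Key
    key i = proj₁ (val∈⁻ (∈-sort⁻ vals (∈-lookup i)))

    val-key : ∀ i → val (key i) ≡ sorted i
    val-key i = proj₂ (val∈⁻ (∈-sort⁻ vals (∈-lookup i)))

    sorted-reflects-< : ∀ {i j} → sorted i <ₚ sorted j → i Fin.< j
    sorted-reflects-< {i} {j} lt with Finₚ.<-cmp i j
    ... | tri< i<j _ _  = i<j
    ... | tri≈ _ refl _ = ⊥-elim (<ₚ-irrefl lt)
    ... | tri> _ _ j<i  = ⊥-elim (<ₚ-irrefl (<ₚ-trans lt (sorted-increasing j<i)))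

    sorted-injective : ∀ {i j} → sorted i ≡ sorted j → i ≡ j
    sorted-injective {i} {j} eq with Finₚ.<-cmp i j
    ... | tri< i<j _ _ = ⊥-elim (<ₚ-irrefl (subst (sorted i <ₚ_) (sym eq) (sorted-increasing i<j)))
    ... | tri≈ _ i≡j _ = i≡j
    ... | tri> _ _ j<i = ⊥-elim (<ₚ-irrefl (subst (_<ₚ sorted i) (sym eq) (sorted-increasing j<i)))

    position-mono : ∀ {κ κ′} → val κ <ₚ val κ′ → position κ Fin.< position κ′
    position-mono {κ} {κ′} lt = sorted-reflects-<
      (subst₂ _<ₚ_ (sym (sorted-position κ)) (sym (sorted-position κ′)) lt)

    position-cong : ∀ {κ κ′} → val κ ≡ val κ′ → position κ ≡ position κ′
    position-cong {κ} {κ′} eq = sorted-injective (trans (sorted-position κ) (trans eq (sym (sorted-position κ′))))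

    position-reflects-≡ : ∀ {κ κ′} → position κ ≡ position κ′ → val κ ≡ val κ′
    position-reflects-≡ {κ} {κ′} eq = trans (sym (sorted-position κ)) (trans (cong sorted eq) (sorted-position κ′))

    val-key-position : ∀ κ → val (key (position κ)) ≡ val κ
    val-key-position κ = trans (val-key (position κ)) (sorted-position κ)

    EKey : Key → Key → Set
    EKey (inj₂ x) (inj₂ y) = FE A x y
    EKey (inj₂ x) (inj₁ y) = ⊥
    EKey (inj₁ x) _        = ⊥

    EKey? : ∀ κ κ′ → Dec (EKey κ κ′)
    EKey? (inj₁ x) _        = no λ ()
    EKey? (inj₂ x) (inj₁ y) = no λ ()
    EKey? (inj₂ x) (inj₂ y) = map′ (proj₂ (presE ε x y)) (proj₁ (presE ε x y))
      ((ρ x ℚₚ.≟ ρ y) ×-dec ET? (τ x) (τ y))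

    val-injective : ∀ {x y} → val (inj₂ x) ≡ val (inj₂ y) → x ≡ y
    val-injective {x} {y} eq with map ε x in eqx | map ε y in eqy
    val-injective {x} {y} refl | _ | _ = inj ε x y (trans eqx (sym eqy))

    -- The points of a block are different keys for one marker, and `key` picks some representative.
    -- The relation read off at it must not depend on the choice.
    EKey-resp : ∀ κ₁ κ₂ {κ₁′ κ₂′} → val κ₁ ≡ val κ₁′ → val κ₂ ≡ val κ₂′ → EKey κ₁ κ₂ → EKey κ₁′ κ₂′
    EKey-resp (inj₂ x) (inj₂ y) {inj₂ x′} {inj₂ y′} eq eq′ e =
      subst₂ (FE A) (val-injective eq) (val-injective eq′) e
    EKey-resp (inj₂ x) (inj₂ y) {inj₁ x′} {_} eq eq′ e with cong proj₂ eq
    ... | ()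
    EKey-resp (inj₂ x) (inj₂ y) {inj₂ x′} {inj₁ y′} eq eq′ e with cong proj₂ eq′
    ... | ()

    relation : Rel len
    relation i j = does (EKey? (key i) (key j))

    relation-position : ∀ κ κ′ → (relation (position κ) (position κ′) ≡ true) ⇔ EKey κ κ′
    relation-position κ κ′ =
      (λ t → EKey-resp k₁ k₂ (val-key-position κ) (val-key-position κ′) (does⇒ (EKey? k₁ k₂) t)) ,
      (λ e → ⇒does (EKey? k₁ k₂) (EKey-resp κ κ′ (sym (val-key-position κ)) (sym (val-key-position κ′)) e))
      where
      k₁ = key (position κ)
      k₂ = key (position κ′)

    SameBlock : Fin (size A) → Fin (size A) → Set
    SameBlock x y = x ≡ y ⊎ (FE A x y ⊎ FE A y x)

    -- Blocks are definable from `E` because each block is a tournament. Hence embeddings of `A` in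
    -- `B` preserve and reflect blocks although the labels `ρ` of `A` and `B` are unrelated.
    ρ⇒block : ∀ {x y} → ρ x ≡ ρ y → SameBlock x y
    ρ⇒block {x} {y} eq with compare (τ x) (τ y)
    ... | inj₂ (inj₁ eq′) = inj₁ (ε-injective eq eq′)
    ... | inj₁ lt with E-total lt
    ...   | inj₁ e = inj₂ (inj₁ (proj₂ (presE ε x y) (eq , e)))
    ...   | inj₂ e = inj₂ (inj₂ (proj₂ (presE ε y x) (sym eq , e)))
    ρ⇒block {x} {y} eq | inj₂ (inj₂ gt) with E-total gt
    ...   | inj₁ e = inj₂ (inj₂ (proj₂ (presE ε y x) (sym eq , e)))
    ...   | inj₂ e = inj₂ (inj₁ (proj₂ (presE ε x y) (eq , e)))

    block⇒ρ : ∀ {x y} → SameBlock x y → ρ x ≡ ρ y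
    block⇒ρ         (inj₁ refl)     = refl
    block⇒ρ {x} {y} (inj₂ (inj₁ e)) = proj₁ (proj₁ (presE ε x y) e)
    block⇒ρ {x} {y} (inj₂ (inj₂ e)) = sym (proj₁ (proj₁ (presE ε y x) e))

  -- Extending an embedding to the markers

  module Extend {A B : FinStr k} (εA : Emb (fin A) (Iω* T)) (εB : Emb (fin B) (Iω* T))
                (g : Emb (fin A) (fin B)) where
    private
      module A = Marked A εA
      module B = Marked B εB

    block⁺ : ∀ {x y} → A.ρ x ≡ A.ρ y → B.ρ (map g x) ≡ B.ρ (map g y)
    block⁺ {x} {y} eq with A.ρ⇒block eq
    ... | inj₁ refl     = refl
    ... | inj₂ (inj₁ e) = B.block⇒ρ (inj₂ (inj₁ (proj₁ (presE g x y) e)))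
    ... | inj₂ (inj₂ e) = B.block⇒ρ (inj₂ (inj₂ (proj₁ (presE g y x) e)))

    block⁻ : ∀ {x y} → B.ρ (map g x) ≡ B.ρ (map g y) → A.ρ x ≡ A.ρ y
    block⁻ {x} {y} eq with B.ρ⇒block eq
    ... | inj₁ eq′      = A.block⇒ρ (inj₁ (inj g x y eq′))
    ... | inj₂ (inj₁ e) = A.block⇒ρ (inj₂ (inj₁ (proj₂ (presE g x y) e)))
    ... | inj₂ (inj₂ e) = A.block⇒ρ (inj₂ (inj₂ (proj₂ (presE g y x) e)))

    Lt⁺ : ∀ {x y} → Lt (Iω* T) (map εA x) (map εA y) → Lt (Iω* T) (map εB (map g x)) (map εB (map g y))
    Lt⁺ {x} {y} lt = proj₁ (presLt εB (map g x) (map g y)) (proj₁ (presLt g x y) (proj₂ (presLt εA x y) lt))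

    -- Since `g` preserves the order, the step could only collapse into a single block of `B`, and
    -- `block⁻` excludes that.
    ρ<⁺ : ∀ {x y} → A.ρ x ℚ.< A.ρ y → B.ρ (map g x) ℚ.< B.ρ (map g y)
    ρ<⁺ lt with Lt⁺ (inj₁ lt)
    ... | inj₁ lt′      = lt′
    ... | inj₂ (eq , _) = ⊥-elim (ℚₚ.<-irrefl (block⁻ eq) lt)

    keyMap : A.Key → B.Key
    keyMap (inj₁ x) = inj₁ (map g x)
    keyMap (inj₂ x) = inj₂ (map g x)

    keyMap-mono : ∀ κ κ′ → A.val κ <ₚ A.val κ′ → B.val (keyMap κ) <ₚ B.val (keyMap κ′)
    keyMap-mono (inj₁ x) (inj₁ y) (inj₁ lt) = inj₁ (ρ<⁺ lt)
    keyMap-mono (inj₁ x) (inj₂ y) (inj₁ lt) = inj₁ (ρ<⁺ lt)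
    keyMap-mono (inj₂ x) (inj₁ y) (inj₁ lt) = inj₁ (ρ<⁺ lt)
    keyMap-mono (inj₂ x) (inj₂ y) (inj₁ lt) = inj₁ (ρ<⁺ lt)
    keyMap-mono (inj₁ x) (inj₂ y) (inj₂ (eq , marker<)) = inj₂ (block⁺ eq , marker<)
    keyMap-mono (inj₂ x) (inj₂ y) (inj₂ (eq , point< lt)) with Lt⁺ (inj₂ (eq , lt))
    ... | inj₁ lt′         = inj₁ lt′
    ... | inj₂ (eq′ , lt′) = inj₂ (eq′ , point< lt′)

    keyMap-cong : ∀ κ κ′ → A.val κ ≡ A.val κ′ → B.val (keyMap κ) ≡ B.val (keyMap κ′)
    keyMap-cong (inj₁ x) (inj₁ y) eq = cong (_, nothing) (block⁺ (cong proj₁ eq))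
    keyMap-cong (inj₂ x) (inj₂ y) eq = cong (B.val ∘ inj₂ ∘ map g) (A.val-injective eq)
    keyMap-cong (inj₁ x) (inj₂ y) eq with cong proj₂ eq
    ... | ()
    keyMap-cong (inj₂ x) (inj₁ y) eq with cong proj₂ eq
    ... | ()

    EKey-keyMap : ∀ κ κ′ → B.EKey (keyMap κ) (keyMap κ′) ⇔ A.EKey κ κ′
    EKey-keyMap (inj₂ x) (inj₂ y) = ⇔-sym (presE g x y)
    EKey-keyMap (inj₂ x) (inj₁ y) = id , id
    EKey-keyMap (inj₁ x) (inj₂ y) = id , id
    EKey-keyMap (inj₁ x) (inj₁ y) = id , id

    positionMap : Fin A.len → Fin B.len
    positionMap i = B.position (keyMap (A.key i))

    positionMap-mono : ∀ {i j} → i Fin.< j → positionMap i Fin.< positionMap j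
    positionMap-mono {i} {j} i<j = B.position-mono (keyMap-mono (A.key i) (A.key j)
      (subst₂ _<ₚ_ (sym (A.val-key i)) (sym (A.val-key j)) (A.sorted-increasing i<j)))

    positionMap-position : ∀ κ → positionMap (A.position κ) ≡ B.position (keyMap κ)
    positionMap-position κ = B.position-cong (keyMap-cong _ κ (A.val-key-position κ))

    g⁺ : A.len ⊑ B.len
    g⁺ = proj₁ (fromIncreasing positionMap positionMap-mono)

    g⁺-eq : ∀ i → ⟦ g⁺ ⟧ i ≡ positionMap i
    g⁺-eq = proj₂ (fromIncreasing positionMap positionMap-mono)

    g⁺-position : ∀ κ → ⟦ g⁺ ⟧ (A.position κ) ≡ B.position (keyMap κ)
    g⁺-position κ = trans (g⁺-eq _) (positionMap-position κ)

    g⁺-relation : ∀ i j → B.relation (⟦ g⁺ ⟧ i) (⟦ g⁺ ⟧ j) ≡ A.relation i j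
    g⁺-relation i j = trans (cong₂ B.relation (g⁺-eq i) (g⁺-eq j)) (sym (does-≡ (A.EKey? κ κ′)
      (λ e → proj₂ (B.relation-position (keyMap κ) (keyMap κ′)) (proj₂ (EKey-keyMap κ κ′) e))
      (λ t → proj₁ (EKey-keyMap κ κ′) (proj₁ (B.relation-position (keyMap κ) (keyMap κ′)) t))))
      where
      κ κ′ : A.Key
      κ  = A.key i
      κ′ = A.key j

    τ-type : ∀ x i → P T i (B.τ (map g x)) ⇔ P T i (A.τ x)
    τ-type x i = ⇔-trans (⇔-sym (presP εB i (map g x))) (⇔-trans (⇔-sym (presP g i x)) (presP εA i x))

  -- The target structure and the copies inside it

  module Target {p q : ℕ} (G : PartiteRel p q) (real : Realisation T G) where
    open Realisation real

    εC-map : Fin (p * number) → ℚ × Carrier T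
    εC-map z = rational (proj₁ (remQuot {p} number z)) , point (proj₂ (remQuot {p} number z))

    C : FinStr k
    C = record
      { size = p * number
      ; FE   = λ y z → E (Iω* T) (εC-map y) (εC-map z)
      ; FLt  = λ y z → Lt (Iω* T) (εC-map y) (εC-map z)
      ; FP   = λ i z → P (Iω* T) i (εC-map z)
      }

    εC-injective : ∀ y z → εC-map y ≡ εC-map z → y ≡ z
    εC-injective y z eq = trans (sym (combine-remQuot {p} number y)) (trans
      (cong₂ combine (rational-injective (cong proj₁ eq)) (point-injective (cong proj₂ eq)))
      (combine-remQuot {p} number z))

    εC : Emb (fin C) (Iω* T)
    εC = record
      { map = εC-map ; inj = εC-injective
      ; presE = λ _ _ → id , id ; presLt = λ _ _ → id , id ; presP = λ _ _ → id , id }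

    εC-combine : ∀ i m → εC-map (combine i m) ≡ (rational i , point m)
    εC-combine i m = cong (λ z → rational (proj₁ z) , point (proj₂ z)) (remQuot-combine {p} {number} i m)

    module Hat (A : FinStr k) (ε : Emb (fin A) (Iω* T)) where
      open Marked A ε

      hat : len ⊑ p → (Fin len → Fin q) → Fin (size A) → Fin (p * number)
      hat e t x = combine (⟦ e ⟧ (position (inj₁ x)))
                          (place (⟦ e ⟧ (position (inj₂ x))) (t (position (inj₂ x))) (τ x))

      module _ (e : len ⊑ p) (t : Fin len → Fin q) (copy : CopyOver relation G e t) where

        label : Fin (size A) → ℚ
        label x = rational (⟦ e ⟧ (position (inj₁ x)))

        spot : Fin (size A) → Carrier T
        spot x = point (place (⟦ e ⟧ (position (inj₂ x))) (t (position (inj₂ x))) (τ x))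

        label-cong : ∀ {x y} → ρ x ≡ ρ y → label x ≡ label y
        label-cong {x} {y} eq = cong (rational ∘ ⟦ e ⟧) (position-cong {inj₁ x} {inj₁ y} (cong (_, nothing) eq))

        label-injective : ∀ {x y} → label x ≡ label y → ρ x ≡ ρ y
        label-injective {x} {y} eq = cong proj₁
          (position-reflects-≡ {inj₁ x} {inj₁ y} (⟦⟧-injective e (rational-injective eq)))

        label-mono : ∀ {x y} → ρ x ℚ.< ρ y → label x ℚ.< label y
        label-mono {x} {y} lt = rational-mono (⟦⟧-mono e (position-mono {inj₁ x} {inj₁ y} (inj₁ lt)))

        label-reflects-< : ∀ {x y} → label x ℚ.< label y → ρ x ℚ.< ρ y
        label-reflects-< {x} {y} lt with ℚₚ.<-cmp (ρ x) (ρ y)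
        ... | tri< ρ< _ _ = ρ<
        ... | tri≈ _ eq _ = ⊥-elim (ℚₚ.<-irrefl (label-cong eq) lt)
        ... | tri> _ _ ρ> = ⊥-elim (ℚₚ.<-irrefl refl (ℚₚ.<-trans lt (label-mono ρ>)))

        -- Within a block `E` of `A` is `E` of `T`, so the copy makes `G` record the edge of `T`,
        -- and monotonicity of `e` orders the parts: exactly what `place-Lt` and `place-E` ask for.
        spot-below : ∀ {x y} → ρ x ≡ ρ y → Lt T (τ x) (τ y) →
                     Lt T (spot x) (spot y) × (E T (spot x) (spot y) ⇔ E T (τ x) (τ y))
        spot-below {x} {y} eq lt = place-Lt lt below same , place-E lt below same
          where
          below : ⟦ e ⟧ (position (inj₂ x)) Fin.< ⟦ e ⟧ (position (inj₂ y))
          below = ⟦⟧-mono e (position-mono {inj₂ x} {inj₂ y} (inj₂ (eq , point< lt)))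
          same : (G _ _ _ _ ≡ true) ⇔ E T (τ x) (τ y)
          same = ⇔-trans ((λ t → trans (sym (copy _ _)) t) , (λ t → trans (copy _ _) t))
            (⇔-trans (relation-position (inj₂ x) (inj₂ y))
            (⇔-trans (presE ε x y) (proj₂ , (eq ,_))))

        record Agree (x y : Fin (size A)) : Set where
          field
            agreeE  : E T (τ x) (τ y) ⇔ E T (spot x) (spot y)
            agreeLt : Lt T (τ x) (τ y) ⇔ Lt T (spot x) (spot y)
            agree≡  : spot x ≡ spot y → x ≡ y

        agree : ∀ x y → ρ x ≡ ρ y → Agree x y
        agree x y eq with compare (τ x) (τ y)
        ... | inj₁ lt = let (lt′ , E⇔) = spot-below eq lt in record
          { agreeE  = ⇔-sym E⇔
          ; agreeLt = (λ _ → lt′) , (λ _ → lt)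
          ; agree≡  = λ eq′ → ⊥-elim (irrefl (subst (Lt T (spot x)) (sym eq′) lt′)) }
        ... | inj₂ (inj₁ eq′) with ε-injective eq eq′
        ...   | refl = record
          { agreeE  = (λ e → ⊥-elim (E-asym e e)) , (λ e → ⊥-elim (E-asym e e))
          ; agreeLt = (λ lt → ⊥-elim (irrefl lt)) , (λ lt → ⊥-elim (irrefl lt))
          ; agree≡  = λ _ → refl }
        agree x y eq | inj₂ (inj₂ gt) = let (gt′ , E⇔) = spot-below (sym eq) gt in record
          { agreeE  = (λ e → other gt′ λ e′ → E-asym e (proj₁ E⇔ e′)) ,
                      (λ e → other gt λ e′ → E-asym e (proj₂ E⇔ e′))
          ; agreeLt = (λ lt → ⊥-elim (irrefl (trans< lt gt))) , (λ lt → ⊥-elim (irrefl (trans< lt gt′)))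
          ; agree≡  = λ eq′ → ⊥-elim (irrefl (subst (Lt T (spot y)) eq′ gt′)) }
          where
          other : ∀ {u v} → Lt T v u → ¬ E T v u → E T u v
          other lt ne with E-total lt
          ... | inj₁ e = ⊥-elim (ne e)
          ... | inj₂ e = e

        open Agree

        εC-hat : ∀ x → εC-map (hat e t x) ≡ (label x , spot x)
        εC-hat x = εC-combine _ _

        hatE : ∀ x y → E (Iω* T) (map ε x) (map ε y) ⇔ E (Iω* T) (label x , spot x) (label y , spot y)
        hatE x y =
          (λ { (eq , e) → label-cong eq , proj₁ (agreeE (agree x y eq)) e }) ,
          (λ { (eq , e) → let eq′ = label-injective eq in eq′ , proj₂ (agreeE (agree x y eq′)) e })

        hatLt : ∀ x y → Lt (Iω* T) (map ε x) (map ε y) ⇔ Lt (Iω* T) (label x , spot x) (label y , spot y)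
        hatLt x y =
          (λ { (inj₁ lt) → inj₁ (label-mono lt)
             ; (inj₂ (eq , lt)) → inj₂ (label-cong eq , proj₁ (agreeLt (agree x y eq)) lt) }) ,
          (λ { (inj₁ lt) → inj₁ (label-reflects-< lt)
             ; (inj₂ (eq , lt)) → let eq′ = label-injective eq in inj₂ (eq′ , proj₂ (agreeLt (agree x y eq′)) lt) })

        hat-embedding : Emb (fin A) (fin C)
        hat-embedding = record
          { map = hat e t
          ; inj = λ x y eq →
              let eq′ = trans (sym (εC-hat x)) (trans (cong εC-map eq) (εC-hat y))
              in agree≡ (agree x y (label-injective (cong proj₁ eq′))) (cong proj₂ eq′)
          ; presE = λ x y → ⇔-trans (presE ε x y)
              (subst₂ (λ u v → E (Iω* T) (map ε x) (map ε y) ⇔ E (Iω* T) u v)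
                (sym (εC-hat x)) (sym (εC-hat y)) (hatE x y))
          ; presLt = λ x y → ⇔-trans (presLt ε x y)
              (subst₂ (λ u v → Lt (Iω* T) (map ε x) (map ε y) ⇔ Lt (Iω* T) u v)
                (sym (εC-hat x)) (sym (εC-hat y)) (hatLt x y))
          ; presP = λ i x → ⇔-trans (presP ε i x)
              (subst (λ u → P T i (τ x) ⇔ P (Iω* T) i u) (sym (εC-hat x)) (⇔-sym (place-P i _ _ _)))
          }

    -- This carries monochromaticity over from the marked structures to the target. The parts agree
    -- because `g⁺` moves markers and points as `g` does; the points `τ` of `A` and `B` differ but
    -- satisfy the same predicates, which `place-type` absorbs.
    hat-natural : ∀ {A B} (εA : Emb (fin A) (Iω* T)) (εB : Emb (fin B) (Iω* T)) (g : Emb (fin A) (fin B)) →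
      let open Extend εA εB g in ∀ e t x →
      Hat.hat B εB e t (map g x) ≡ Hat.hat A εA (g⁺ ⊙ e) (lookup (tabulate (t ∘ ⟦ g⁺ ⟧))) x
    hat-natural {A} {B} εA εB g e t x = cong₂ combine (part (inj₁ x)) (begin
      place (⟦ e ⟧ (B.position (inj₂ (map g x)))) (t (B.position (inj₂ (map g x)))) (B.τ (map g x))
        ≡⟨ place-type (τ-type x) ⟩
      place (⟦ e ⟧ (B.position (inj₂ (map g x)))) (t (B.position (inj₂ (map g x)))) (A.τ x)
        ≡⟨ cong₂ (λ j u → place j u (A.τ x)) (part (inj₂ x))
             (trans (cong t (sym (g⁺-position (inj₂ x)))) (sym (Vecₚ.lookup∘tabulate _ (A.position (inj₂ x))))) ⟩
      place (⟦ g⁺ ⊙ e ⟧ (A.position (inj₂ x))) (lookup (tabulate (t ∘ ⟦ g⁺ ⟧)) (A.position (inj₂ x))) (A.τ x) ∎)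
      where
      open ≡-Reasoning
      open Extend εA εB g
      module A = Marked A εA
      module B = Marked B εB
      part : ∀ κ → ⟦ e ⟧ (B.position (keyMap κ)) ≡ ⟦ g⁺ ⊙ e ⟧ (A.position κ)
      part κ = trans (cong ⟦ e ⟧ (sym (g⁺-position κ))) (sym (⟦⟧-⊙ g⁺ e (A.position κ)))

  ramsey-property : (∀ {p q} (G : PartiteRel p q) → Realisation T G) → RamseyProperty (Age (Iω* T))
  -- Without colours there is no colouring, since `χ` would have to colour the empty subset.
  ramsey-property realise zero A B εA εB = B , εB , λ χ → ⊥-elim (no-colour (χ Subset.⊥))
    where
    no-colour : Fin 0 → ⊥
    no-colour ()
  ramsey-property realise (suc r) A B εA εB
    with ordered-relation-ramsey r (Marked.relation A εA) (Marked.relation B εB)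
  ... | p , q , G , ram = C , εC , colour
    where
    open Target G (realise G)
    module HA = Hat A εA
    module HB = Hat B εB

    colour : ∀ (χ : Subset (size C) → Fin (suc r)) → Σ (Subset (size C)) λ B′ → IsCopy B C B′ ×
             Σ (Fin (suc r)) λ c → ∀ S → S Subset.⊆ B′ → IsCopy A C S → χ S ≡ c
    -- The pulled-back colouring is defined for every `e` and `t`: `hat` yields a map, and so an
    -- image to colour, even when these do not form a copy.
    colour χ with ram (λ e t → χ (image (HA.hat e (lookup t))))
    ... | e , t , copy , c , mono = image (map f) , (f , ∈-image (map f)) , c , monochromatic
      where
      f : Emb (fin B) (fin C)
      f = HB.hat-embedding e t copy

      monochromatic : ∀ S → S Subset.⊆ image (map f) → IsCopy A C S → χ S ≡ c
      monochromatic S S⊆ (h , S-char) = begin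
        χ S
          ≡⟨ cong χ (image-unique (map h) S S-char) ⟩
        χ (image (map h))
          ≡⟨ cong χ (image-cong (λ x → sym (f∘g x))) ⟩
        χ (image (map f ∘ g₀))
          ≡⟨ cong χ (image-cong (hat-natural εA εB g e t)) ⟩
        χ (image (HA.hat (g⁺ ⊙ e) (lookup (tabulate (t ∘ ⟦ g⁺ ⟧)))))
          ≡⟨ mono g⁺ g⁺-relation ⟩
        c ∎
        where
        open ≡-Reasoning
        -- As `S` lies in the image of `f`, the map `h` factors through `f`; since `f` reflects all
        -- relations, the factor `g` is an embedding of `A` in `B`.
        factor : ∀ x → ∃ λ y → map f y ≡ map h x
        factor x = proj₁ (∈-image (map f) (map h x)) (S⊆ (proj₂ (S-char (map h x)) (x , refl)))
        g₀ : Fin (size A) → Fin (size B)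
        g₀ x = proj₁ (factor x)
        f∘g : ∀ x → map f (g₀ x) ≡ map h x
        f∘g x = proj₂ (factor x)
        g : Emb (fin A) (fin B)
        g = record
          { map = g₀
          ; inj = λ x y eq → inj h x y (trans (sym (f∘g x)) (trans (cong (map f) eq) (f∘g y)))
          ; presE = λ x y → ⇔-trans (presE h x y) (⇔-sym
              (subst₂ (λ u v → FE B (g₀ x) (g₀ y) ⇔ FE C u v) (f∘g x) (f∘g y) (presE f (g₀ x) (g₀ y))))
          ; presLt = λ x y → ⇔-trans (presLt h x y) (⇔-sym
              (subst₂ (λ u v → FLt B (g₀ x) (g₀ y) ⇔ FLt C u v) (f∘g x) (f∘g y) (presLt f (g₀ x) (g₀ y))))
          ; presP = λ i x → ⇔-trans (presP h i x) (⇔-sym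
              (subst (λ u → FP B i (g₀ x) ⇔ FP C i u) (f∘g x) (presP f i (g₀ x))))
          }
        open Extend εA εB g

-- The finite tournaments and ℚ

Fin-order : ∀ {n} → LinearOrder (Fin._<_ {n})
Fin-order = record { irrefl = ℕₚ.<-irrefl refl ; trans< = ℕₚ.<-trans ; compare = compare }
  where
  compare : ∀ {n} (i j : Fin n) → i Fin.< j ⊎ i ≡ j ⊎ j Fin.< i
  compare i j with Finₚ.<-cmp i j
  ... | tri< lt _ _ = inj₁ lt
  ... | tri≈ _ eq _ = inj₂ (inj₁ eq)
  ... | tri> _ _ gt = inj₂ (inj₂ gt)

ℚ-order : LinearOrder ℚ._<_
ℚ-order = record { irrefl = ℚₚ.<-irrefl refl ; trans< = ℚₚ.<-trans ; compare = compare }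
  where
  compare : ∀ x y → x ℚ.< y ⊎ x ≡ y ⊎ y ℚ.< x
  compare x y with ℚₚ.<-cmp x y
  ... | tri< lt _ _ = inj₁ lt
  ... | tri≈ _ eq _ = inj₂ (inj₁ eq)
  ... | tri> _ _ gt = inj₂ (inj₂ gt)

I1-tournament : OrderedTournament I1*
I1-tournament = record
  { order = record { irrefl = λ () ; trans< = λ () ; compare = λ _ _ → inj₂ (inj₁ refl) }
  ; E-total = λ () ; E-asym = λ () }

I1-realise : ∀ {p q} (G : PartiteRel p q) → Realisation I1* G
I1-realise G = record
  { number = 1 ; point = λ _ → tt ; point-injective = λ { {zero} {zero} _ → refl }
  ; place = λ _ _ _ → zero ; place-Lt = λ () ; place-E = λ ()
  ; place-P = λ _ _ _ _ → id , id ; place-type = λ _ → refl }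

C3-tournament : OrderedTournament C3*
C3-tournament = record { order = Fin-order ; E-total = total _ _ ; E-asym = λ { e01 () ; e12 () ; e20 () } }
  where
  total : ∀ x y → x Fin.< y → C3E x y ⊎ C3E y x
  total zero             (suc zero)       _ = inj₁ e01
  total zero             (suc (suc zero)) _ = inj₂ e20
  total (suc zero)       (suc (suc zero)) _ = inj₁ e12
  total zero             zero             ()
  total (suc zero)       zero             ()
  total (suc zero)       (suc zero)       (s≤s ())
  total (suc (suc zero)) zero             ()
  total (suc (suc zero)) (suc zero)       (s≤s ())
  total (suc (suc zero)) (suc (suc zero)) (s≤s (s≤s ()))

-- The unary predicates name the three vertices, so every vertex can be placed at itself.
C3-realise : ∀ {p q} (G : PartiteRel p q) → Realisation C3* G
C3-realise G = record
  { number = 3 ; point = id ; point-injective = id ; place = λ _ _ x → x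
  ; place-Lt = λ lt _ _ → lt ; place-E = λ _ _ _ → id , id
  ; place-P = λ _ _ _ _ → id , id ; place-type = λ {_} {_} {x} types → proj₁ (types x) refl }

Q-tournament : OrderedTournament Q*
Q-tournament = record { order = ℚ-order ; E-total = inj₁ ; E-asym = λ lt gt → ℚₚ.<-irrefl refl (ℚₚ.<-trans lt gt) }

-- Here `E` and `Lt` coincide, so the parts in their order can serve as the points.
Q-realise : ∀ {p q} (G : PartiteRel p q) → Realisation Q* G
Q-realise {p} G = record
  { number = p ; point = rational ; point-injective = rational-injective ; place = λ j _ _ → j
  ; place-Lt = λ _ j<j′ _ → rational-mono j<j′
  ; place-E = λ lt j<j′ _ → (λ _ → lt) , (λ _ → rational-mono j<j′)
  ; place-P = λ () ; place-type = λ _ → refl }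

-- The generic tournament

module Generic (M : Str 0) (generic : IsGenericLOTournament M) where

  Tω-tournament : OrderedTournament M
  Tω-tournament = let (carrier , (_ , E-tot , E-as , Lt-irr , Lt-tr , Lt-tot) , _) = generic in record
    { order = record { irrefl = Lt-irr _ ; trans< = Lt-tr _ _ _ ; compare = compare carrier Lt-tot }
    ; E-total = λ {x} {y} lt → E-tot x y λ { refl → Lt-irr x lt }
    ; E-asym = E-as _ _ }
    where
    compare : Carrier M ≡ ℕ → (∀ x y → ¬ x ≡ y → Lt M x y ⊎ Lt M y x) → ∀ x y → Lt M x y ⊎ x ≡ y ⊎ Lt M y x
    -- Totality applies only to distinct points; equality is decided through the identification of
    -- the carrier with ℕ.
    compare carrier Lt-tot x y with subst DecidableEquality (sym carrier) ℕₚ._≟_ x y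
    ... | yes eq = inj₂ (inj₁ eq)
    ... | no ne with Lt-tot x y ne
    ...   | inj₁ lt = inj₁ lt
    ...   | inj₂ gt = inj₂ (inj₂ gt)

  module _ {p q : ℕ} (G : PartiteRel p q) where

    edge : Fin (p * q) → Fin (p * q) → Bool
    edge y z = let (j , u) = remQuot {p} q y ; (j′ , v) = remQuot {p} q z in G j u j′ v

    -- Reading `G` only at increasing pairs, with `false` as the reversed edge, turns an arbitrary
    -- Boolean relation into a tournament. Pairs from increasing parts are increasing, so their
    -- values survive.
    WE : Fin (p * q) → Fin (p * q) → Set
    WE y z = (y Fin.< z × edge y z ≡ true) ⊎ (z Fin.< y × edge z y ≡ false)

    W : FinStr 0
    W = record { size = p * q ; FE = WE ; FLt = Fin._<_ ; FP = λ () }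

    W-tournament : IsLOTournament (fin W)
    W-tournament = irreflexive , total , asymmetric , (λ _ → ℕₚ.<-irrefl refl) , (λ _ _ _ → ℕₚ.<-trans) , Lt-total
      where
      irreflexive : ∀ x → ¬ WE x x
      irreflexive x (inj₁ (lt , _)) = ℕₚ.<-irrefl refl lt
      irreflexive x (inj₂ (lt , _)) = ℕₚ.<-irrefl refl lt
      Lt-total : ∀ x y → ¬ x ≡ y → x Fin.< y ⊎ y Fin.< x
      Lt-total x y ne with Finₚ.<-cmp x y
      ... | tri< lt _ _ = inj₁ lt
      ... | tri≈ _ eq _ = ⊥-elim (ne eq)
      ... | tri> _ _ gt = inj₂ gt
      below : ∀ x y → x Fin.< y → WE x y ⊎ WE y x
      below x y lt with edge x y
      ... | true  = inj₁ (inj₁ (lt , refl))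
      ... | false = inj₂ (inj₂ (lt , refl))
      total : ∀ x y → ¬ x ≡ y → WE x y ⊎ WE y x
      total x y ne with Lt-total x y ne
      ... | inj₁ lt = below x y lt
      ... | inj₂ gt = swap (below y x gt)
      true≢false : ∀ {b} → b ≡ true → ¬ b ≡ false
      true≢false refl ()
      asymmetric : ∀ x y → WE x y → ¬ WE y x
      asymmetric x y (inj₁ (lt , _)) (inj₁ (gt , _)) = ℕₚ.<-asym lt gt
      asymmetric x y (inj₁ (_ , t))  (inj₂ (_ , f))  = true≢false t f
      asymmetric x y (inj₂ (_ , f))  (inj₁ (_ , t))  = true≢false t f
      asymmetric x y (inj₂ (lt , _)) (inj₂ (gt , _)) = ℕₚ.<-asym lt gt

    -- The extension property over the empty structure gives universality.
    W-embedding : Emb (fin W) M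
    W-embedding = proj₁ (extension ∅ W ∅-tournament W-tournament (∅-embedding (fin W)) (∅-embedding M))
      where
      extension = proj₂ (proj₂ generic)
      ∅ : FinStr 0
      ∅ = record { size = 0 ; FE = λ () ; FLt = λ () ; FP = λ () }
      ∅-tournament : IsLOTournament (fin ∅)
      ∅-tournament = (λ ()) , (λ ()) , (λ ()) , (λ ()) , (λ ()) , λ ()
      ∅-embedding : ∀ N → Emb (fin ∅) N
      ∅-embedding N = record { map = λ () ; inj = λ () ; presE = λ () ; presLt = λ () ; presP = λ () }

    edge-combine : ∀ j u j′ v → edge (combine j u) (combine j′ v) ≡ G j u j′ v
    edge-combine j u j′ v = cong₂ (λ y z → G (proj₁ y) (proj₂ y) (proj₁ z) (proj₂ z))
      (remQuot-combine {p} {q} j u) (remQuot-combine {p} {q} j′ v)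

    Tω-realise : Realisation M G
    Tω-realise = record
      { number = p * q ; point = map W-embedding ; point-injective = inj W-embedding _ _
      ; place = λ j u _ → combine j u
      ; place-Lt = λ _ j<j′ _ → proj₁ (presLt W-embedding _ _) (Finₚ.combine-monoˡ-< _ _ j<j′)
      ; place-E = λ {j} {u} {x} {j′} {v} {y} _ j<j′ same →
          ⇔-trans (⇔-sym (presE W-embedding _ _)) (⇔-trans (edge⇔ u v j<j′) same)
      ; place-P = λ () ; place-type = λ _ → refl }
      where
      edge⇔ : ∀ {j j′} u v → j Fin.< j′ → WE (combine j u) (combine j′ v) ⇔ (G j u j′ v ≡ true)
      edge⇔ {j} {j′} u v j<j′ = to , λ t → inj₁ (lt , trans (edge-combine j u j′ v) t)
        where
        lt : combine j u Fin.< combine j′ v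
        lt = Finₚ.combine-monoˡ-< u v j<j′
        to : WE (combine j u) (combine j′ v) → G j u j′ v ≡ true
        to (inj₁ (_ , t))  = trans (sym (edge-combine j u j′ v)) t
        to (inj₂ (gt , _)) = ⊥-elim (ℕₚ.<-asym lt gt)

-- The dense local order

odd⇒2∤ : ∀ n → n % 2 ≡ 1 → ¬ 2 ∣ n
odd⇒2∤ n odd 2∣n with trans (sym odd) (n∣m⇒m%n≡0 n 2 2∣n)
... | ()

-- Clearing denominators in a difference of ½ writes the product of the two denominators as twice an
-- integer, but that product is odd.
not-antipodal : ∀ x y → ℚ.denominatorℕ x % 2 ≡ 1 → ℚ.denominatorℕ y % 2 ≡ 1 → ¬ y ℚ.- x ≡ ½
not-antipodal x@(mkℚ m c _) y@(mkℚ n d _) oddx oddy eq = odd⇒2∤ (suc d * suc c)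
  (trans (%-distribˡ-* (suc d) (suc c) 2) (cong₂ (λ a b → (a * b) % 2) oddy oddx))
  (divides ℤ.∣ numerator ∣ (begin
    suc d * suc c               ≡⟨⟩
    ℤ.∣ + (suc d * suc c) ∣     ≡⟨ cong ℤ.∣_∣ (trans (sym (ℤₚ.*-identityˡ (+ (suc d * suc c))))
                                                 (sym (ℚᵘₚ.drop-*≡* difference))) ⟩
    ℤ.∣ numerator ℤ.* + 2 ∣     ≡⟨ ℤₚ.abs-* numerator (+ 2) ⟩
    ℤ.∣ numerator ∣ * 2         ∎))
  where
  open ≡-Reasoning
  numerator : ℤ
  numerator = n ℤ.* + suc c ℤ.+ (ℤ.- m) ℤ.* + suc d
  difference : mkℚᵘ n d ℚᵘ.+ mkℚᵘ (ℤ.- m) c ℚᵘ.≃ toℚᵘ ½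
  difference = ℚᵘₚ.≃-trans
    (ℚᵘₚ.≃-sym (ℚᵘₚ.≃-trans (ℚₚ.toℚᵘ-homo-+ y (ℚ.- x)) (ℚᵘₚ.+-congʳ (mkℚᵘ n d) (ℚₚ.toℚᵘ-homo‿- x))))
    (ℚₚ.toℚᵘ-cong eq)

D-≡ : {x y : D} → proj₁ x ≡ proj₁ y → x ≡ y
D-≡ {x , a , b , c} {.x , a′ , b′ , c′} refl
  rewrite ℚₚ.≤-irrelevant a a′ | ℚₚ.<-irrelevant b b′ | ℕₚ.≡-irrelevant c c′ = refl

data Arc (x : ℚ) : Set where
  left   : x ℚ.< ¼ → Arc x
  middle : ¼ ℚ.< x → x ℚ.< ¾ → Arc x
  right  : ¾ ℚ.< x → Arc x

arc : (x : D) → Arc (proj₁ x)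
arc (x , _ , _ , odd) with ℚₚ.<-cmp x ¼
... | tri< lt _ _   = left lt
... | tri≈ _ refl _ = ⊥-elim (odd⇒2∤ 4 odd (divides 2 refl))
... | tri> _ _ gt with ℚₚ.<-cmp x ¾
...   | tri< lt _ _   = middle gt lt
...   | tri≈ _ refl _ = ⊥-elim (odd⇒2∤ 4 odd (divides 2 refl))
...   | tri> _ _ gt′  = right gt′

half : ∀ {x} → Arc x → Fin 2
half (left _)     = zero
half (middle _ _) = suc zero
half (right _)    = zero

-- Reflecting the second half onto the first one turns S2Lt into the order of the angles.
angle : ∀ {x} → Arc x → ℚ
angle {x} (left _)     = x ℚ.+ 1ℚ
angle {x} (middle _ _) = x ℚ.+ ½
angle {x} (right _)    = x

¼<¾ : ¼ ℚ.< ¾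
¼<¾ = from-yes (¼ ℚₚ.<? ¾)

<-asymℚ : ∀ {x y} → x ℚ.< y → ¬ y ℚ.< x
<-asymℚ lt gt = ℚₚ.<-irrefl refl (ℚₚ.<-trans lt gt)

-+-cancel : ∀ x y → y ℚ.- x ℚ.+ x ≡ y
-+-cancel x y = trans (ℚₚ.+-assoc y (ℚ.- x) x) (trans (cong (y ℚ.+_) (ℚₚ.+-inverseˡ x)) (ℚₚ.+-identityʳ y))

near : ∀ {x y} → y ℚ.- x ℚ.< ½ → y ℚ.< x ℚ.+ ½
near {x} {y} lt = subst₂ ℚ._<_ (-+-cancel x y) (ℚₚ.+-comm ½ x) (ℚₚ.+-monoˡ-< x lt)

far : ∀ {x y} → ½ ℚ.< x ℚ.- y → y ℚ.+ ½ ℚ.< x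
far {x} {y} lt = subst₂ ℚ._<_ (ℚₚ.+-comm ½ y) (-+-cancel y x) (ℚₚ.+-monoˡ-< y lt)

+½+½ : ∀ x → x ℚ.+ ½ ℚ.+ ½ ≡ x ℚ.+ 1ℚ
+½+½ x = ℚₚ.+-assoc x ½ ½

Turn : ∀ {x y} → Arc x → Arc y → Set
Turn α β = (half α ≡ half β × angle α ℚ.< angle β) ⊎ (¬ half α ≡ half β × angle β ℚ.< angle α)

-- The unit is a full turn, and the first half wraps around 0. Adding 1 on its left arc and ½ on the
-- other half brings all angles into the interval from ¾ to 5/4, of length ½, where `E` follows the
-- order; moving one of the two points by a half turn reverses `E`. The remaining combinations of
-- arcs and inequalities contradict each other.
E⇒turn : ∀ x y → S2E x y → (α : Arc (proj₁ x)) (β : Arc (proj₁ y)) → Turn α β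
E⇒turn (x , 0≤x , x<1 , _) (y , 0≤y , y<1 , _) = λ
  { (inj₁ (x<y , d)) (left _)      (left _)      → inj₁ (refl , ℚₚ.+-monoˡ-< 1ℚ x<y)
  ; (inj₂ (_ , d))   (left x<¼)    (left _)      →
      ⊥-elim (<-asymℚ (ℚₚ.<-trans (far {x} {y} d) x<¼) (ℚₚ.<-≤-trans (from-yes (¼ ℚₚ.<? ½)) (½≤ 0≤y)))
  ; (inj₁ (_ , d))   (left _)      (middle _ _)  →
      inj₂ ((λ ()) , subst (y ℚ.+ ½ ℚ.<_) (+½+½ x) (ℚₚ.+-monoˡ-< ½ {y} {x ℚ.+ ½} (near {x} {y} d)))
  ; (inj₂ (y<x , _)) (left x<¼)    (middle ¼<y _) → ⊥-elim (<-asymℚ y<x (ℚₚ.<-trans x<¼ ¼<y))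
  ; (inj₁ (_ , d))   (left x<¼)    (right ¾<y)   →
      ⊥-elim (<-asymℚ (near {x} {y} d) (ℚₚ.<-trans (ℚₚ.+-monoˡ-< ½ x<¼) ¾<y))
  ; (inj₂ (y<x , _)) (left x<¼)    (right ¾<y)   → ⊥-elim (<-asymℚ y<x (ℚₚ.<-trans x<¼ (ℚₚ.<-trans ¼<¾ ¾<y)))
  ; (inj₁ (x<y , _)) (middle ¼<x _) (left y<¼)   → ⊥-elim (<-asymℚ x<y (ℚₚ.<-trans y<¼ ¼<x))
  ; (inj₂ (_ , d))   (middle _ _)  (left _)      →
      inj₂ ((λ ()) , subst (ℚ._< x ℚ.+ ½) (+½+½ y) (ℚₚ.+-monoˡ-< ½ {y ℚ.+ ½} {x} (far {x} {y} d)))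
  ; (inj₁ (x<y , _)) (middle _ _)  (middle _ _)  → inj₁ (refl , ℚₚ.+-monoˡ-< ½ x<y)
  ; (inj₂ (_ , d))   (middle _ x<¾) (middle ¼<y _) →
      ⊥-elim (<-asymℚ (ℚₚ.<-trans (far {x} {y} d) x<¾) (ℚₚ.+-monoˡ-< ½ ¼<y))
  ; (inj₁ (_ , d))   (middle _ _)  (right _)     → inj₂ ((λ ()) , near {x} {y} d)
  ; (inj₂ (y<x , _)) (middle _ x<¾) (right ¾<y)  → ⊥-elim (<-asymℚ y<x (ℚₚ.<-trans x<¾ ¾<y))
  ; (inj₁ (x<y , _)) (right ¾<x)   (left y<¼)    → ⊥-elim (<-asymℚ x<y (ℚₚ.<-trans y<¼ (ℚₚ.<-trans ¼<¾ ¾<x)))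
  ; (inj₂ (_ , _))   (right _)     (left _)      → inj₁ (refl , ℚₚ.<-≤-trans x<1 (ℚₚ.+-monoˡ-≤ 1ℚ 0≤y))
  ; (inj₁ (x<y , _)) (right ¾<x)   (middle _ y<¾) → ⊥-elim (<-asymℚ x<y (ℚₚ.<-trans y<¾ ¾<x))
  ; (inj₂ (_ , d))   (right _)     (middle _ _)  → inj₂ ((λ ()) , far {x} {y} d)
  ; (inj₁ (x<y , _)) (right _)     (right _)     → inj₁ (refl , x<y)
  ; (inj₂ (_ , d))   (right _)     (right ¾<y)   →
      ⊥-elim (<-asymℚ (ℚₚ.<-trans (far {x} {y} d) x<1)
                       (ℚₚ.<-trans (from-yes (1ℚ ℚₚ.<? ¾ ℚ.+ ½)) (ℚₚ.+-monoˡ-< ½ ¾<y)))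
  }
  where
  ½≤ : ∀ {y} → 0ℚ ℚ.≤ y → ½ ℚ.≤ y ℚ.+ ½
  ½≤ 0≤y = ℚₚ.+-monoˡ-≤ ½ 0≤y

φ : D → ℚ
φ x = angle (arc x)

side : D → Fin 2
side x = half (arc x)

S2E-turn : ∀ {x y} → S2E x y → (side x ≡ side y × φ x ℚ.< φ y) ⊎ (¬ side x ≡ side y × φ y ℚ.< φ x)
S2E-turn {x} {y} e = E⇒turn x y e (arc x) (arc y)

S2E-asym : ∀ {x y} → S2E x y → ¬ S2E y x
S2E-asym {x} {y} e e′ with S2E-turn {x} {y} e | S2E-turn {y} {x} e′
... | inj₁ (_ , lt)   | inj₁ (_ , gt)   = <-asymℚ lt gt
... | inj₁ (same , _) | inj₂ (diff , _) = diff (sym same)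
... | inj₂ (diff , _) | inj₁ (same , _) = diff (sym same)
... | inj₂ (_ , lt)   | inj₂ (_ , gt)   = <-asymℚ lt gt

S2E-total : ∀ x y → x ≡ y ⊎ (S2E x y ⊎ S2E y x)
S2E-total X@(x , _ , _ , oddx) Y@(y , _ , _ , oddy) with ℚₚ.<-cmp x y
... | tri≈ _ eq _ = inj₁ (D-≡ eq)
... | tri< x<y _ _ with ℚₚ.<-cmp (y ℚ.- x) ½
...   | tri< lt _ _ = inj₂ (inj₁ (inj₁ (x<y , lt)))
...   | tri≈ _ eq _ = ⊥-elim (not-antipodal x y oddx oddy eq)
...   | tri> _ _ gt = inj₂ (inj₂ (inj₂ (x<y , gt)))
S2E-total X@(x , _ , _ , oddx) Y@(y , _ , _ , oddy) | tri> _ _ y<x with ℚₚ.<-cmp (x ℚ.- y) ½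
...   | tri< lt _ _ = inj₂ (inj₂ (inj₁ (y<x , lt)))
...   | tri≈ _ eq _ = ⊥-elim (not-antipodal y x oddy oddx eq)
...   | tri> _ _ gt = inj₂ (inj₁ (inj₂ (y<x , gt)))

HalfP-half : ∀ i x (α : Arc (proj₁ x)) → HalfP i x ⇔ (half α ≡ i)
HalfP-half zero       x (left lt)     = (λ _ → refl) , (λ _ → inj₁ lt)
HalfP-half zero       x (right gt)    = (λ _ → refl) , (λ _ → inj₂ gt)
HalfP-half zero       x (middle gt lt) =
  (λ { (inj₁ lt′) → ⊥-elim (<-asymℚ gt lt′) ; (inj₂ gt′) → ⊥-elim (<-asymℚ lt gt′) }) , λ ()
HalfP-half (suc zero) x (left lt)     = (λ { (gt , _) → ⊥-elim (<-asymℚ gt lt) }) , λ ()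
HalfP-half (suc zero) x (right gt)    = (λ { (_ , lt) → ⊥-elim (<-asymℚ gt lt) }) , λ ()
HalfP-half (suc zero) x (middle gt lt) = (λ _ → refl) , (λ _ → gt , lt)

HalfP-side : ∀ i x → HalfP i x ⇔ (side x ≡ i)
HalfP-side i x = HalfP-half i x (arc x)

SameHalf⇔side : ∀ x y → SameHalf x y ⇔ (side x ≡ side y)
SameHalf⇔side x y = to , from (side y) refl
  where
  to : SameHalf x y → side x ≡ side y
  to (inj₁ (hx , hy)) = trans (proj₁ (HalfP-side zero x) hx) (sym (proj₁ (HalfP-side zero y) hy))
  to (inj₂ (hx , hy)) = trans (proj₁ (HalfP-side (suc zero) x) hx) (sym (proj₁ (HalfP-side (suc zero) y) hy))
  from : ∀ i → side y ≡ i → side x ≡ side y → SameHalf x y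
  from zero       eq same = inj₁ (proj₂ (HalfP-side zero x) (trans same eq) , proj₂ (HalfP-side zero y) eq)
  from (suc zero) eq same = inj₂ (proj₂ (HalfP-side (suc zero) x) (trans same eq) , proj₂ (HalfP-side (suc zero) y) eq)

S2Lt⇒φ< : ∀ {x y} → S2Lt x y → φ x ℚ.< φ y
S2Lt⇒φ< {x} {y} (inj₁ (same , e)) with S2E-turn {x} {y} e
... | inj₁ (_ , lt)   = lt
... | inj₂ (diff , _) = ⊥-elim (diff (proj₁ (SameHalf⇔side x y) same))
S2Lt⇒φ< {x} {y} (inj₂ (diff , e)) with S2E-turn {y} {x} e
... | inj₁ (same , _) = ⊥-elim (diff (proj₂ (SameHalf⇔side x y) (sym same)))
... | inj₂ (_ , lt)   = lt

S2Lt-total : ∀ x y → S2Lt x y ⊎ x ≡ y ⊎ S2Lt y x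
S2Lt-total x y with S2E-total x y
... | inj₁ eq = inj₂ (inj₁ eq)
... | inj₂ (inj₁ e) with S2E-turn {x} {y} e
...   | inj₁ (same , _) = inj₁ (inj₁ (proj₂ (SameHalf⇔side x y) same , e))
...   | inj₂ (diff , _) = inj₂ (inj₂ (inj₂ ((λ s → diff (sym (proj₁ (SameHalf⇔side y x) s))) , e)))
S2Lt-total x y | inj₂ (inj₂ e) with S2E-turn {y} {x} e
...   | inj₁ (same , _) = inj₂ (inj₂ (inj₁ (proj₂ (SameHalf⇔side y x) same , e)))
...   | inj₂ (diff , _) = inj₁ (inj₂ ((λ s → diff (sym (proj₁ (SameHalf⇔side x y) s))) , e))

φ<⇒S2Lt : ∀ {x y} → φ x ℚ.< φ y → S2Lt x y
φ<⇒S2Lt {x} {y} lt with S2Lt-total x y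
... | inj₁ lt′         = lt′
... | inj₂ (inj₁ refl) = ⊥-elim (ℚₚ.<-irrefl refl lt)
... | inj₂ (inj₂ gt)   = ⊥-elim (<-asymℚ lt (S2Lt⇒φ< {y} {x} gt))

S2Lt-irrefl : ∀ x → ¬ S2Lt x x
S2Lt-irrefl x lt = ℚₚ.<-irrefl refl (S2Lt⇒φ< {x} {x} lt)

S2-tournament : OrderedTournament S2*
S2-tournament = record
  { order = record
    { irrefl  = λ {x} → S2Lt-irrefl x
    ; trans<  = λ {x} {y} {z} lt lt′ → φ<⇒S2Lt {x} {z} (ℚₚ.<-trans (S2Lt⇒φ< {x} {y} lt) (S2Lt⇒φ< {y} {z} lt′))
    ; compare = S2Lt-total }
  ; E-total = λ { (inj₁ (_ , e)) → inj₁ e ; (inj₂ (_ , e)) → inj₂ e }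
  ; E-asym  = λ {x} {y} → S2E-asym {x} {y} }

-- Below in the order, the direction of the edge is determined by the halves. Hence placing points
-- in increasing order and in their own halves already reproduces `E`.
S2Lt⇒E⇔side : ∀ {x y} → S2Lt x y → S2E x y ⇔ (side x ≡ side y)
S2Lt⇒E⇔side {x} {y} (inj₁ (same , e)) = (λ _ → proj₁ (SameHalf⇔side x y) same) , (λ _ → e)
S2Lt⇒E⇔side {x} {y} (inj₂ (diff , e)) =
  (λ e′ → ⊥-elim (S2E-asym {x} {y} e′ e)) , (λ same → ⊥-elim (diff (proj₂ (SameHalf⇔side x y) same)))

/-mono-< : ∀ m n c d → m * suc d ℕ.< n * suc c → (+ m ℚ./ suc c) ℚ.< (+ n ℚ./ suc d)
/-mono-< m n c d lt = ℚₚ.toℚᵘ-cancel-<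
  (ℚᵘₚ.<-respˡ-≃ (ℚᵘₚ.≃-sym (ℚₚ.toℚᵘ-fromℚᵘ (mkℚᵘ (+ m) c)))
  (ℚᵘₚ.<-respʳ-≃ (ℚᵘₚ.≃-sym (ℚₚ.toℚᵘ-fromℚᵘ (mkℚᵘ (+ n) d)))
  (ℚᵘ.*<* (subst₂ ℤ._<_ (ℤₚ.pos-* m (suc d)) (ℤₚ.pos-* n (suc c)) (+<+ lt)))))

-- Two interleaved families of points, one in each half

module Points (p : ℕ) where

  -- `4p + 1` is odd, which gives every fraction an odd reduced denominator. It also puts `2p / d`
  -- and `(2p + 1) / d` on the two sides of ½ and `p / d` just below ¼.
  d : ℕ
  d = suc (p * 2 * 2)

  frac : ℕ → ℚ
  frac m = + m ℚ./ d

  frac-mono-< : ∀ {m n} → m ℕ.< n → frac m ℚ.< frac n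
  frac-mono-< {m} {n} lt = /-mono-< m n _ _ (ℕₚ.*-monoˡ-< d lt)

  frac-mono-≤ : ∀ {m n} → m ℕ.≤ n → frac m ℚ.≤ frac n
  frac-mono-≤ le with ℕₚ.m≤n⇒m<n∨m≡n le
  ... | inj₁ lt   = ℚₚ.<⇒≤ (frac-mono-< lt)
  ... | inj₂ refl = ℚₚ.≤-refl

  frac-+ : ∀ m n → frac (m + n) ≡ frac m ℚ.+ frac n
  frac-+ m n = ℚₚ.toℚᵘ-injective (ℚᵘₚ.≃-trans (to-frac (m + n))
    (ℚᵘₚ.≃-sym (ℚᵘₚ.≃-trans (ℚₚ.toℚᵘ-homo-+ (frac m) (frac n))
      (ℚᵘₚ.≃-trans (ℚᵘₚ.+-cong (to-frac m) (to-frac n)) (ℚᵘ.*≡* same)))))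
    where
    to-frac : ∀ l → toℚᵘ (frac l) ℚᵘ.≃ mkℚᵘ (+ l) (p * 2 * 2)
    to-frac l = ℚₚ.toℚᵘ-fromℚᵘ (mkℚᵘ (+ l) (p * 2 * 2))
    same : (+ m ℤ.* + d ℤ.+ + n ℤ.* + d) ℤ.* + d ≡ + (m + n) ℤ.* + (d * d)
    same = trans (cong (ℤ._* + d) (sym (ℤₚ.*-distribʳ-+ (+ d) (+ m) (+ n))))
      (trans (ℤₚ.*-assoc (+ (m + n)) (+ d) (+ d)) (cong (+ (m + n) ℤ.*_) (sym (ℤₚ.pos-* d d))))

  0≤frac : ∀ m → 0ℚ ℚ.≤ frac m
  0≤frac m = subst (ℚ._≤ frac m)
    (ℚₚ.fromℚᵘ-cong {mkℚᵘ (+ 0) (p * 2 * 2)} {mkℚᵘ (+ 0) 0} (ℚᵘ.*≡* refl)) (frac-mono-≤ {0} {m} z≤n)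

  -- The reduced denominator times `gcd m d` is `d`, so an even one would make `d` even.
  frac-odd : ∀ m → ℚ.denominatorℕ (frac m) % 2 ≡ 1
  frac-odd m with ℚ.denominatorℕ (frac m) % 2 in eq | m%n<n (ℚ.denominatorℕ (frac m)) 2
  ... | suc zero    | _ = refl
  ... | suc (suc _) | s≤s (s≤s ())
  ... | zero        | _ = ⊥-elim (odd⇒2∤ d ([m+kn]%n≡m%n 1 (p * 2) 2)
    (subst (2 ∣_) (ℤₚ.+-injective (trans (ℤₚ.pos-* (ℚ.denominatorℕ (frac m)) (gcd m d)) (ℚₚ.↧-normalize m d)))
      (∣m⇒∣m*n (gcd m d) (m%n≡0⇒n∣m (ℚ.denominatorℕ (frac m)) 2 eq))))

  frac-2p<½ : frac (p * 2) ℚ.< ½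
  frac-2p<½ = /-mono-< (p * 2) 1 _ _ (subst (p * 2 * 2 ℕ.<_) (sym (ℕₚ.*-identityˡ d)) (ℕₚ.n<1+n _))

  ½<frac-2p+1 : ½ ℚ.< frac (suc (p * 2))
  ½<frac-2p+1 = /-mono-< 1 (suc (p * 2)) _ _ (subst (ℕ._< suc (p * 2) * 2) (sym (ℕₚ.*-identityˡ d)) (ℕₚ.n<1+n _))

  -- The second point is ½ + (2 j + 1) / (2 d), which has an odd denominator; reflected
  -- by ½ it lies strictly between the first points j / d and (j + 1) / d.
  first-numerator second-numerator : Fin p → ℕ
  first-numerator j  = Fin.toℕ j
  second-numerator j = Fin.toℕ j + suc (p * 2)

  first<¼ : ∀ j → frac (first-numerator j) ℚ.< ¼
  first<¼ j = /-mono-< (Fin.toℕ j) 1 _ _ (ℕₚ.<-≤-trans (ℕₚ.*-monoˡ-< 4 (Finₚ.toℕ<n j))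
    (ℕₚ.≤-trans (ℕₚ.≤-reflexive (sym (ℕₚ.*-assoc p 2 2)))
      (ℕₚ.≤-trans (ℕₚ.n≤1+n _) (ℕₚ.≤-reflexive (sym (ℕₚ.*-identityˡ d))))))

  second>¼ : ∀ j → ¼ ℚ.< frac (second-numerator j)
  second>¼ j = ℚₚ.<-trans (from-yes (¼ ℚₚ.<? ½)) (ℚₚ.<-≤-trans ½<frac-2p+1 (frac-mono-≤ (ℕₚ.m≤n+m _ (Fin.toℕ j))))

  second-split : ∀ j → frac (second-numerator j) ≡ frac (suc (Fin.toℕ j)) ℚ.+ frac (p * 2)
  second-split j = trans (cong frac (ℕₚ.+-suc (Fin.toℕ j) (p * 2))) (frac-+ (suc (Fin.toℕ j)) (p * 2))

  second<¾ : ∀ j → frac (second-numerator j) ℚ.< ¾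
  second<¾ j = subst (ℚ._< ¾) (sym (second-split j))
    -- The first summand is at most `p / d`, hence at most ¼, and `2p / d` is below ½.
    (ℚₚ.≤-<-trans (ℚₚ.+-monoˡ-≤ (frac (p * 2)) (ℚₚ.≤-trans (frac-mono-≤ (Finₚ.toℕ<n j)) (ℚₚ.<⇒≤ p<¼)))
      (ℚₚ.+-monoʳ-< ¼ frac-2p<½))
    where
    p<¼ : frac p ℚ.< ¼
    p<¼ = /-mono-< p 1 _ _ (subst₂ ℕ._<_ (ℕₚ.*-assoc p 2 2) (sym (ℕₚ.*-identityˡ d)) (ℕₚ.n<1+n _))

  first second : Fin p → D
  first j  = frac (first-numerator j) , 0≤frac (first-numerator j) ,
    ℚₚ.<-trans (first<¼ j) (from-yes (¼ ℚₚ.<? 1ℚ)) , frac-odd (first-numerator j)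
  second j = frac (second-numerator j) , 0≤frac (second-numerator j) ,
    ℚₚ.<-trans (second<¾ j) (from-yes (¾ ℚₚ.<? 1ℚ)) , frac-odd (second-numerator j)

  arc-first : ∀ j → ∃ λ lt → arc (first j) ≡ left lt
  arc-first j with arc (first j)
  ... | left lt     = lt , refl
  ... | middle gt _ = ⊥-elim (<-asymℚ (first<¼ j) gt)
  ... | right gt    = ⊥-elim (<-asymℚ (first<¼ j) (ℚₚ.<-trans ¼<¾ gt))

  arc-second : ∀ j → ∃ λ gt → ∃ λ lt → arc (second j) ≡ middle gt lt
  arc-second j with arc (second j)
  ... | left lt      = ⊥-elim (<-asymℚ (second>¼ j) lt)
  ... | middle gt lt = gt , lt , refl
  ... | right gt     = ⊥-elim (<-asymℚ (second<¾ j) gt)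

  on : Fin p → Fin 2 → D
  on j zero       = first j
  on j (suc zero) = second j

  side-on : ∀ j h → side (on j h) ≡ h
  side-on j zero       = cong half (proj₂ (arc-first j))
  side-on j (suc zero) = cong half (proj₂ (proj₂ (arc-second j)))

  angle-on : Fin p → Fin 2 → ℚ
  angle-on j zero       = frac (first-numerator j) ℚ.+ 1ℚ
  angle-on j (suc zero) = frac (second-numerator j) ℚ.+ ½

  φ-on : ∀ j h → φ (on j h) ≡ angle-on j h
  φ-on j zero       = cong angle (proj₂ (arc-first j))
  φ-on j (suc zero) = cong angle (proj₂ (proj₂ (arc-second j)))

  angle-on-mono : ∀ {j j′} h h′ → j Fin.< j′ → angle-on j h ℚ.< angle-on j′ h′
  angle-on-mono zero zero j<j′ = ℚₚ.+-monoˡ-< 1ℚ (frac-mono-< j<j′)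
  angle-on-mono (suc zero) (suc zero) j<j′ = ℚₚ.+-monoˡ-< ½ (frac-mono-< (ℕₚ.+-monoˡ-< (suc (p * 2)) j<j′))
  angle-on-mono {j} {j′} zero (suc zero) j<j′ = subst₂ ℚ._<_
    (+½+½ (frac (Fin.toℕ j))) (cong (ℚ._+ ½) (sym (frac-+ (Fin.toℕ j′) (suc (p * 2)))))
    (ℚₚ.+-monoˡ-< ½ (ℚₚ.+-mono-< (frac-mono-< j<j′) ½<frac-2p+1))
  -- Reflected, a second point exceeds the first point of its part by half of `1 / d`, so
  -- `suc j ≤ j′` leaves room for it.
  angle-on-mono {j} {j′} (suc zero) zero j<j′ = subst₂ ℚ._<_
    (cong (ℚ._+ ½) (sym (second-split j)))
    (+½+½ (frac (Fin.toℕ j′)))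
    (ℚₚ.+-monoˡ-< ½ (ℚₚ.+-mono-≤-< (frac-mono-≤ j<j′) frac-2p<½))

  on-Lt : ∀ {j j′} h h′ → j Fin.< j′ → S2Lt (on j h) (on j′ h′)
  on-Lt {j} {j′} h h′ j<j′ = φ<⇒S2Lt {on j h} {on j′ h′}
    (subst₂ ℚ._<_ (sym (φ-on j h)) (sym (φ-on j′ h′)) (angle-on-mono h h′ j<j′))

  on-injective : ∀ {j j′ h h′} → on j h ≡ on j′ h′ → j ≡ j′ × h ≡ h′
  on-injective {j} {j′} {h} {h′} eq with Finₚ.<-cmp j j′
  ... | tri< lt _ _   = ⊥-elim (S2Lt-irrefl (on j h) (subst (S2Lt (on j h)) (sym eq) (on-Lt h h′ lt)))
  ... | tri≈ _ refl _ = refl , trans (sym (side-on j h)) (trans (cong side eq) (side-on j h′))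
  ... | tri> _ _ gt   = ⊥-elim (S2Lt-irrefl (on j′ h′) (subst (S2Lt (on j′ h′)) eq (on-Lt h′ h gt)))

S2-realise : ∀ {p q} (G : PartiteRel p q) → Realisation S2* G
S2-realise {p} G = record
  { number = p * 2
  ; point = point
  ; point-injective = λ {m} {n} eq → let (eq₁ , eq₂) = on-injective eq in
      trans (sym (combine-remQuot {p} 2 m)) (trans (cong₂ combine eq₁ eq₂) (combine-remQuot {p} 2 n))
  ; place = λ j _ x → combine j (side x)
  ; place-Lt = λ {j} {_} {x} {j′} {_} {y} _ j<j′ _ → placed-Lt x y j<j′
  ; place-E = λ {j} {_} {x} {j′} {_} {y} lt j<j′ _ →
      ⇔-trans (S2Lt⇒E⇔side {point (combine j (side x))} {point (combine j′ (side y))} (placed-Lt x y j<j′))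
      (⇔-trans (subst₂ (λ h h′ → (h ≡ h′) ⇔ (side x ≡ side y))
                       (sym (side-point j x)) (sym (side-point j′ y)) (id , id))
      (⇔-sym (S2Lt⇒E⇔side {x} {y} lt)))
  ; place-P = λ i j u x → ⇔-trans (HalfP-side i (point (combine j (side x))))
      (subst (λ h → (h ≡ i) ⇔ HalfP i x) (sym (side-point j x)) (⇔-sym (HalfP-side i x)))
  -- A point satisfies the predicate of its own side, and so does any point with the same
  -- predicates; the sides, and with them the places, coincide.
  ; place-type = λ {j} {_} {x} {y} types → cong (combine j)
      (sym (proj₁ (HalfP-side (side x) y) (proj₁ (types (side x)) (proj₂ (HalfP-side (side x) x) refl))))
  }
  where
  open Points p
  point : Fin (p * 2) → D
  point m = let (j , h) = remQuot {p} 2 m in on j h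

  point-combine : ∀ j h → point (combine j h) ≡ on j h
  point-combine j h = cong (λ (i , h′) → on i h′) (remQuot-combine {p} {2} j h)

  side-point : ∀ j x → side (point (combine j (side x))) ≡ side x
  side-point j x = trans (cong side (point-combine j (side x))) (side-on j (side x))

  placed-Lt : ∀ {j j′} x y → j Fin.< j′ → S2Lt (point (combine j (side x))) (point (combine j′ (side y)))
  placed-Lt {j} {j′} x y j<j′ = subst₂ S2Lt
    (sym (point-combine j (side x))) (sym (point-combine j′ (side y))) (on-Lt (side x) (side y) j<j′)

theorem7p4 : (T : HomTournament) → RamseyProperty (Age (Iω* (expansion T)))
theorem7p4 I₁       = Reduction.ramsey-property I1* I1-tournament I1-realise
theorem7p4 C₃       = Reduction.ramsey-property C3* C3-tournament C3-realise
theorem7p4 ℚ-tour   = Reduction.ramsey-property Q* Q-tournament Q-realise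
theorem7p4 S₂       = Reduction.ramsey-property S2* S2-tournament S2-realise
theorem7p4 (Tω M g) = Reduction.ramsey-property M Tω-tournament Tω-realise
  where open Generic M g
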